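{- 3-Sum parameterized by the number $n$ of numbers is 2-OR-decomposable.
   Context: The notation $\widetilde O$ hides polylogarithmic factors. 3-Sum: given an array $A$ of $n$ integers, decide whether there are $i,j,h\in\{1,\dots,n\}$ such that $A[i]+A[j]+A[h]=0$. OR-decomposition: for $\alpha>1$, an $\alpha$-OR-decomposition for a problem $\mathcal P$ with parameter $n$ (a set of pairs $(I,n)$) is an algorithm that, given $\lambda>0$ and an instance $(I,n)$ of $\mathcal P$, computes, for some $\alpha'<\alpha$, in $\widetilde O(n^{\alpha'})$ time $t\in\widetilde O(n^{\alpha\lambda/(\alpha+\lambda)})$ many instances $(I_1,n_1),\dots,(I_t,n_t)$ of $\mathcal P$ such that (i) $(I,n)\in\mathcal P$ if and only if $(I_i,n_i)\in\mathcal P$ for some $i\in\{1,\dots,t\}$, and (ii) $n_i\in\widetilde O(n^{\alpha/(\alpha+\lambda)})$ for all $i$. The problem $\mathcal P$ is $\alpha$-OR-decomposable if an $\alpha$-OR-decomposition for it exists. -}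

module Defs where

open import Data.Bool.Base using (Bool; true; false; if_then_else_)
open import Data.Fin.Base using (Fin)
open import Data.Integer.Base as ℤ using (ℤ; +_; -[1+_]; 0ℤ)
open import Data.List.Base using (List; []; _∷_; _∷ʳ_; concatMap; length)
open import Data.List.Membership.Propositional using (_∈_)
open import Data.List.Relation.Unary.Any using (Any)
open import Data.Nat.Base as ℕ using (ℕ; zero; suc; _+_; _*_; _^_; _≤_; _≡ᵇ_)
open import Data.Nat.Logarithm using (⌊log₂_⌋)
open import Data.Product.Base using (Σ; Σ-syntax; ∃; ∃-syntax; _×_; _,_; proj₁; proj₂)
open import Data.Rational.Base as ℚ using (ℚ; mkℚ; 0ℚ; 1ℚ)
open import Data.Vec.Base as Vec using (Vec; lookup)
open import Data.Vec.Properties as Vec using (toList-injective; cast-is-id)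
open import Function.Bundles using (_⇔_)
open import Relation.Binary.PropositionalEquality using (_≡_; sym; trans)

------------------------------------------------------------------------
-- Real numbers

-- A real x is given by integers a₀, a₁, a₂, … with ∣ aₖ - k x ∣ ≤ 1, that is,
-- by a Bishop-regular sequence of rationals aₖ / k.  (At k = 0, the condition
-- says ∣ a₀ ∣ ≤ 1.)  Every real has such a presentation, e.g. aₖ = ⌊ k x ⌋.

record Real : Set where
  field
    approx  : ℕ → ℤ
    regular : ∀ k l →
      ℤ.∣ approx k ℤ.* + l ℤ.- approx l ℤ.* + k ∣ ≤ k + l

open Real public

infix 4 _ℚ<ℝ_ _ℝ<ℚ_

_ℚ<ℝ_ : ℚ → Real → Set
q ℚ<ℝ x = ∃[ k ] q ℚ.* (+ k ℚ./ 1) ℚ.+ 1ℚ ℚ.< approx x k ℚ./ 1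

_ℝ<ℚ_ : Real → ℚ → Set
x ℝ<ℚ q = ∃[ k ] approx x k ℚ./ 1 ℚ.+ 1ℚ ℚ.< q ℚ.* (+ k ℚ./ 1)

------------------------------------------------------------------------
-- Random access machine
--
-- Programs are structured RAM programs with unit-cost addition, subtraction,
-- comparison and indirect addressing on integers.  Memory consists of
-- registers and arrays (a program mentions only finitely many of each), and
-- there is a write-only output tape.  There is no multiplication, so large
-- numbers cannot be used to pack many operations into one.
--
-- A real number cannot be stored in a register.  A machine that is given a
-- real x accesses it through `real e`, which for e evaluating to v returns an
-- integer at distance at most 1 from ∣ v ∣ * x, and so only O(log ∣ v ∣) bits.

data Expr : Set where
  lit     : ℤ → Expr
  var     : ℕ → Expr
  _⊕_ _⊖_ : Expr → Expr → Expr
  arr     : ℕ → Expr → Expr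
  real    : Expr → Expr

data Test : Set where
  _≼_ : Expr → Expr → Test

data Program : Set where
  skip     : Program
  _≔_      : ℕ → Expr → Program
  _[_]≔_   : ℕ → Expr → Expr → Program
  print    : Expr → Program
  _⨾_      : Program → Program → Program
  ifte     : Test → Program → Program → Program
  while    : Test → Program → Program

infixl 6 _⊕_ _⊖_
infix  5 _≼_
infix  4 _≔_ _[_]≔_
infixr 3 _⨾_

record State : Set where
  constructor state
  field
    register : ℕ → ℤ
    memory   : ℕ → ℤ → ℤ
    output   : List ℤ

open State public

setRegister : ℕ → ℤ → State → State
setRegister x v s = record s
  { register = λ y → if x ≡ᵇ y then v else register s y }

_≡ᵇℤ_ : ℤ → ℤ → Bool
(+ m)    ≡ᵇℤ (+ n)    = m ≡ᵇ n
-[1+ m ] ≡ᵇℤ -[1+ n ] = m ≡ᵇ n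
_        ≡ᵇℤ _        = false

setMemory : ℕ → ℤ → ℤ → State → State
setMemory a i v s = record s
  { memory = λ b j → if a ≡ᵇ b then (if i ≡ᵇℤ j then v else memory s b j)
                     else memory s b j }

append : ℤ → State → State
append v s = record s { output = output s ∷ʳ v }

cost : Expr → ℕ
cost (lit _)    = 1
cost (var _)    = 1
cost (d ⊕ e)    = 1 + cost d + cost e
cost (d ⊖ e)    = 1 + cost d + cost e
cost (arr _ e)  = 1 + cost e
cost (real e)   = 1 + cost e

costᵗ : Test → ℕ
costᵗ (d ≼ e) = 1 + cost d + cost e

module Semantics (x : Real) where

  eval : Expr → State → ℤ
  eval (lit v)    s = v
  eval (var y)    s = register s y
  eval (d ⊕ e)    s = eval d s ℤ.+ eval e s
  eval (d ⊖ e)    s = eval d s ℤ.- eval e s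
  eval (arr a e)  s = memory s a (eval e s)
  eval (real e)   s = approx x ℤ.∣ eval e s ∣

  evalᵗ : Test → State → Bool
  evalᵗ (d ≼ e) s = eval d s ℤ.≤ᵇ eval e s

  infix 2 ⟨_,_⟩⇓[_]_

  -- ⟨ p , s ⟩⇓[ t ] s′ : started in s, p halts in s′ after exactly t steps.
  data ⟨_,_⟩⇓[_]_ : Program → State → ℕ → State → Set where
    ⇓skip : ∀ {s} → ⟨ skip , s ⟩⇓[ 1 ] s
    ⇓≔ : ∀ {s y e} →
      ⟨ y ≔ e , s ⟩⇓[ 1 + cost e ] setRegister y (eval e s) s
    ⇓[]≔ : ∀ {s a d e} →
      ⟨ a [ d ]≔ e , s ⟩⇓[ 1 + cost d + cost e ]
        setMemory a (eval d s) (eval e s) s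
    ⇓print : ∀ {s e} →
      ⟨ print e , s ⟩⇓[ 1 + cost e ] append (eval e s) s
    ⇓⨾ : ∀ {s s′ s″ p q t u} →
      ⟨ p , s ⟩⇓[ t ] s′ → ⟨ q , s′ ⟩⇓[ u ] s″ →
      ⟨ p ⨾ q , s ⟩⇓[ t + u ] s″
    ⇓if-true : ∀ {s s′ b p q t} → evalᵗ b s ≡ true →
      ⟨ p , s ⟩⇓[ t ] s′ → ⟨ ifte b p q , s ⟩⇓[ costᵗ b + t ] s′
    ⇓if-false : ∀ {s s′ b p q t} → evalᵗ b s ≡ false →
      ⟨ q , s ⟩⇓[ t ] s′ → ⟨ ifte b p q , s ⟩⇓[ costᵗ b + t ] s′
    ⇓while-false : ∀ {s b p} → evalᵗ b s ≡ false →
      ⟨ while b p , s ⟩⇓[ costᵗ b ] s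
    ⇓while-true : ∀ {s s′ s″ b p t u} → evalᵗ b s ≡ true →
      ⟨ p , s ⟩⇓[ t ] s′ → ⟨ while b p , s′ ⟩⇓[ u ] s″ →
      ⟨ while b p , s ⟩⇓[ costᵗ b + (t + u) ] s″

------------------------------------------------------------------------
-- Problems with a parameter

record ParamProblem : Set₁ where
  field
    Instance         : ℕ → Set
    Yes              : ∀ {n} → Instance n → Set
    encode           : ∀ {n} → Instance n → List ℤ
    encode-injective : ∀ {n} {I J : Instance n} → encode I ≡ encode J → I ≡ J

  ParamInstance : Set
  ParamInstance = Σ ℕ Instance

  serialise : ParamInstance → List ℤ
  serialise (n , I) = + n ∷ + length (encode I) ∷ encode I

  serialiseAll : List ParamInstance → List ℤ
  serialiseAll = concatMap serialise

-- The i-th entry of a list (counting from 0), and 0 outside of the list.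
cells : List ℤ → ℤ → ℤ
cells []       _         = 0ℤ
cells (_ ∷ _)  -[1+ _ ]  = 0ℤ
cells (v ∷ _)  (+ zero)  = v
cells (_ ∷ vs) (+ suc i) = cells vs (+ i)

-- The parameter is in register 0, the length of the encoding in register 1 and
-- the encoding itself in array 0; everything else is 0.
initial : (P : ParamProblem) → ParamProblem.ParamInstance P → State
initial P (n , I) = state registers arrays []
  where
  open ParamProblem P
  registers : ℕ → ℤ
  registers 0 = + n
  registers 1 = + length (encode I)
  registers _ = 0ℤ
  arrays : ℕ → ℤ → ℤ
  arrays 0 = cells (encode I)
  arrays _ = λ _ → 0ℤ

------------------------------------------------------------------------
-- Soft-O bounds

-- y ≤ c · n ^ r for a rational exponent r = p / (1 + d), raised to the power
-- 1 + d to stay within ℕ.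
_≤_·_^ℚ_ : ℕ → ℕ → ℕ → ℚ → Set
y ≤ c · n ^ℚ mkℚ (+ p)    d _ = y ^ suc d ≤ c ^ suc d * n ^ p
y ≤ c · n ^ℚ mkℚ -[1+ p ] d _ = y ^ suc d * n ^ suc p ≤ c ^ suc d

-- f x ∈ Õ(n ^ e), where n = size x and e is the infimum of the set R of
-- rationals: since n ^ e = inf { n ^ r ∣ r ∈ R } for n ≥ 1, the bound is
-- required for all r ∈ R, with constants that do not depend on r.
SoftO : {X : Set} (f size : X → ℕ) (R : ℚ → Set) → Set
SoftO {X} f size R =
  ∃[ C ] ∃[ k ] ∀ (x : X) → 1 ≤ size x → ∀ r → R r →
    f x ≤ C * suc ⌊log₂ size x ⌋ ^ k · size x ^ℚ r

-- The rationals r with r > α x / (α + x), for α, x > 0: by monotonicity in x,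
-- those with r ≥ α μ / (α + μ) for some rational μ > x.
AboveCountExponent : ℚ → Real → ℚ → Set
AboveCountExponent α x r =
  ∃[ μ ] (x ℝ<ℚ μ) × (α ℚ.* μ ℚ.≤ r ℚ.* (α ℚ.+ μ))

-- The rationals r with r > α / (α + x), for α, x > 0: by antitonicity in x,
-- those with r ≥ α / (α + μ) for some rational 0 < μ < x.
AboveSizeExponent : ℚ → Real → ℚ → Set
AboveSizeExponent α x r =
  ∃[ μ ] (0ℚ ℚ.< μ) × (μ ℚ<ℝ x) × (α ℚ.≤ r ℚ.* (α ℚ.+ μ))

------------------------------------------------------------------------
-- OR-decompositions

-- What a program has to achieve for a fixed real x (the λ of the literature).
-- The constants in the bounds, and α′, may depend on x.  Taking α′ rational is
-- no restriction, as there is a rational between any α′ < α and α.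
record Decomposes (α : ℚ) (P : ParamProblem) (p : Program) (x : Real) : Set where
  open ParamProblem P
  open Semantics x
  field
    decomposition : ParamInstance → List ParamInstance
    time          : ParamInstance → ℕ
    final         : ParamInstance → State
    halts         : ∀ I → ⟨ p , initial P I ⟩⇓[ time I ] final I
    prints        : ∀ I → output (final I) ≡ serialiseAll (decomposition I)

    α′            : ℚ
    α′<α          : α′ ℚ.< α
    time-bound    : SoftO time proj₁ (_≡ α′)

    count-bound   : SoftO (λ I → length (decomposition I)) proj₁
                      (AboveCountExponent α x)

    equivalent    : ∀ I →
      Yes (proj₂ I) ⇔ Any (λ J → Yes (proj₂ J)) (decomposition I)

    size-bound    :
      SoftO {X = Σ[ I ∈ ParamInstance ] Σ[ J ∈ ParamInstance ]
                   J ∈ decomposition I}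
            (λ (_ , (m , _) , _) → m) (λ ((n , _) , _) → n)
            (AboveSizeExponent α x)

-- A single program has to work for all x > 0.
_-OR-Decomposable_ : ℚ → ParamProblem → Set
α -OR-Decomposable P =
  (1ℚ ℚ.< α) ×
  (Σ[ p ∈ Program ] ∀ (x : Real) → 0ℚ ℚ<ℝ x → Decomposes α P p x)

------------------------------------------------------------------------
-- 3-Sum

3-Sum : ParamProblem
3-Sum = record
  { Instance         = Vec ℤ
  ; Yes              = λ {n} A → Σ[ i ∈ Fin n ] Σ[ j ∈ Fin n ] Σ[ h ∈ Fin n ]
                         lookup A i ℤ.+ lookup A j ℤ.+ lookup A h ≡ 0ℤ
  ; encode           = Vec.toList
  ; encode-injective = λ {n} {A} {B} eq →
      trans (sym (cast-is-id _≡_.refl A)) (toList-injective _≡_.refl A B eq)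
  }

{-# OPTIONS --safe #-}

-- Pad the input to N = 2 ^ L numbers, sort it, and cut it into g = 2 ^ j blocks
-- of B = 2 ^ m numbers, where m + j = L.  Up to constant factors, B and g have
-- to be N ^ (2 / (2 + λ)) and N ^ (λ / (2 + λ)), so 2 j and λ m have to agree up
-- to a constant, and since λ is known up to 1 / m from the m-th approximation,
-- it suffices to take the first m with 2 j < 2 + approx λ (m + 1).
--
-- A solution lies in three blocks a ≤ b and c.  For a fixed distance b - a, the
-- sums of the last elements of a and b increase with a, while c is to decrease:
-- walking through a upwards and c downwards with two pointers, it is enough to
-- output the (at most 2 g) triples of blocks that are visited.  If the sum of the
-- last elements of a and b and the first element of c is ≤ 0, then a can be left,
-- and otherwise c can be left.  This gives at most 2 g ^ 2 instances of size 3 B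
-- in time O(N g) after an O(N log N) sort.

module Submission where

open import Defs
open import Data.Bool.Base using (Bool; true; false; if_then_else_)
open import Data.Bool.Properties using (T-≡)
open import Data.Integer.Base as ℤ using (ℤ; +_; -[1+_]; 0ℤ; ∣_∣; +≤+; -≤+; +<+)
import Data.Integer.Properties as ℤ
import Data.Integer.Solver as ℤ
open import Data.List.Base using (List; []; _∷_; [_]; _∷ʳ_; _++_; length; merge; concat; map)
open import Data.List.Properties
  using (++-assoc; ++-identityʳ; length-++; concat-++; concat-map-[_]; length-map; concatMap-++)
open import Data.List.Membership.Propositional using (_∈_; find)
import Data.List.Membership.Propositional.Properties as List
open import Data.List.Relation.Binary.Permutation.Propositional
  using (_↭_; ↭-trans; ↭-sym; ↭-reflexive; module PermutationReasoning)
open import Data.List.Relation.Binary.Permutation.Propositional.Properties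
  using (merge-↭; ↭-length; ∈-resp-↭; ++⁺ʳ; ++-comm)
open import Data.List.Relation.Unary.All as All using (All; []; _∷_)
import Data.List.Relation.Unary.All.Properties as All
open import Data.List.Relation.Unary.AllPairs using (AllPairs; []; _∷_)
open import Data.List.Relation.Unary.Any using (Any; here; there)
import Data.List.Relation.Unary.Any.Properties as Any
import Data.List.Relation.Unary.Linked as Linked
open import Data.List.Relation.Unary.Linked.Properties using (Linked⇒AllPairs)
open import Data.List.Relation.Unary.Sorted.TotalOrder ℤ.≤-totalOrder using (Sorted)
import Data.List.Relation.Unary.Sorted.TotalOrder.Properties as Sorted
open import Data.Nat.Base as ℕ
  using (ℕ; zero; suc; _+_; _*_; _^_; _∸_; _≤_; _<_; _≡ᵇ_; z≤n; s≤s)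
open import Data.Nat.Coprimality using (Coprime)
import Data.Nat.DivMod as ℕ
open import Data.Nat.Logarithm using (⌊log₂_⌋; ⌊log₂⌋-mono-≤; ⌊log₂[2^n]⌋≡n)
import Data.Nat.Properties as ℕ
open import Data.Nat.Solver using (module +-*-Solver)
open import Data.Product.Base using (Σ; _×_; _,_; proj₁; proj₂; ∃-syntax)
open import Data.Rational.Base as ℚ using (ℚ; mkℚ; 0ℚ; 1ℚ; toℚᵘ; ↥_; ↧_; _/_)
import Data.Rational.Properties as ℚ
open import Data.Rational.Unnormalised.Base as ℚᵘ using (ℚᵘ; mkℚᵘ; 1ℚᵘ; *<*)
import Data.Rational.Unnormalised.Properties as ℚᵘ
open import Data.Sum.Base using (_⊎_; inj₁; inj₂; map₁)
open import Data.Unit.Base using (⊤; tt)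
open import Data.Vec.Base as Vec using (Vec; []; _∷_; lookup; toList; fromList)
open import Data.Vec.Properties using (toList∘fromList; length-toList)
import Data.Vec.Membership.Propositional.Properties as Vec
import Data.Vec.Relation.Unary.Any as Vec
import Data.Vec.Relation.Unary.Any.Properties as Vec
open import Function.Base using (id; _∘_)
open import Function.Bundles using (_⇔_; mk⇔; Equivalence)
open import Relation.Binary.PropositionalEquality hiding ([_]; J)
open import Relation.Nullary using (¬_; yes; no; contradiction; does)

open ParamProblem 3-Sum using (Yes; ParamInstance; serialise; serialiseAll)

-- Lists on a tape

-- Since `x` is accessible only up to an error of 1, the block length cannot be chosen exactly. One
-- factor 2 is moved at a time from the number of blocks to the block length, and every error
-- becomes an additive constant in an exponent of 2, hence a constant factor. So all bounds are
-- first proved as integer inequalities between exponents of 2. As `SoftO` wants constants that do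
-- not depend on the exponent `r`, large `r` are treated apart. The machine neither multiplies nor
-- divides, whence powers of 2 and pointers that move by whole blocks. The time bound needs a fixed
-- exponent below 2: for an integer M ≥ λ the number of blocks is at most about N ^ (M / (2 + M)),
-- which puts N g below N ^ 2 by a fixed power of N. Padding repeats the first number. Positions of
-- a solution may coincide, so neither these copies nor blocks that occur twice in a triple affect
-- the answer. States are functions and have no normal form, so programs are executed symbolically
-- on lists. The memory stays a list because cells are never overwritten: the sort is a bottom-up
-- merge sort on a queue that grows at the end of array 0.

data At : List ℤ → ℕ → ℤ → Set where
  here  : ∀ {l v} → At (v ∷ l) zero v
  there : ∀ {l i u v} → At l i v → At (u ∷ l) (suc i) v

At-cells : ∀ {l i v} → At l i v → cells l (+ i) ≡ v
At-cells here      = refl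
At-cells (there p) = At-cells p

At-++ : ∀ {l i v} r → At l i v → At (l ++ r) i v
At-++ r here      = here
At-++ r (there p) = there (At-++ r p)

At-length : ∀ l {v r} → At (l ++ v ∷ r) (length l) v
At-length []      = here
At-length (_ ∷ l) = there (At-length l)

Segment : List ℤ → ℕ → List ℤ → Set
Segment l a []       = ⊤
Segment l a (x ∷ xs) = At l a x × Segment l (suc a) xs

-- As the tape only grows, this is the frame property that carries unread data across every write.
Segment-++ : ∀ {l a} r xs → Segment l a xs → Segment (l ++ r) a xs
Segment-++ r []       _       = tt
Segment-++ r (x ∷ xs) (p , q) = At-++ r p , Segment-++ r xs q

Segment-there : ∀ {l u a} xs → Segment l a xs → Segment (u ∷ l) (suc a) xs
Segment-there []       _       = tt
Segment-there (x ∷ xs) (p , q) = there p , Segment-there xs q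

Segment-refl : ∀ l → Segment l 0 l
Segment-refl []      = tt
Segment-refl (x ∷ l) = here , Segment-there l (Segment-refl l)

Segment-split : ∀ {l} a xs {ys} → Segment l a (xs ++ ys) →
  Segment l a xs × Segment l (a + length xs) ys
Segment-split {l} a []       {ys} s       =
  tt , subst (λ b → Segment l b ys) (sym (ℕ.+-identityʳ a)) s
Segment-split {l} a (x ∷ xs) {ys} (p , s) with Segment-split (suc a) xs s
... | s₁ , s₂ = (p , s₁) , subst (λ b → Segment l b ys) (sym (ℕ.+-suc a (length xs))) s₂

Segment-join : ∀ {l} a xs {ys} → Segment l a xs →
  Segment l (a + length xs) ys → Segment l a (xs ++ ys)
Segment-join {l} a []       {ys} _       t = subst (λ b → Segment l b ys) (ℕ.+-identityʳ a) t
Segment-join {l} a (x ∷ xs) {ys} (p , s) t =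
  p , Segment-join (suc a) xs s (subst (λ b → Segment l b ys) (ℕ.+-suc a (length xs)) t)

Segment-cells : ∀ {l} a xs {i} → Segment l a xs → i < length xs →
  cells l (+ (a + i)) ≡ cells xs (+ i)
Segment-cells {l} a (x ∷ xs) {zero}  (p , s) _ =
  trans (cong (λ b → cells l (+ b)) (ℕ.+-identityʳ a)) (At-cells p)
Segment-cells {l} a (x ∷ xs) {suc i} (p , s) (s≤s i<) =
  trans (cong (λ b → cells l (+ b)) (ℕ.+-suc a i)) (Segment-cells (suc a) xs s i<)

cells-∷ʳ : ∀ l v i →
  (if (+ length l) ≡ᵇℤ i then v else cells l i) ≡ cells (l ∷ʳ v) i
cells-∷ʳ []      v (+ zero)   = refl
cells-∷ʳ []      v (+ suc i)  = refl
cells-∷ʳ []      v -[1+ i ]   = refl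
cells-∷ʳ (x ∷ l) v (+ zero)   = refl
cells-∷ʳ (x ∷ l) v (+ suc i)  = cells-∷ʳ l v (+ i)
cells-∷ʳ (x ∷ l) v -[1+ i ]   = refl

-- Total correctness of programs with a time bound

-- Registers that are not listed contain 0.
nth : List ℤ → ℕ → ℤ
nth []       _       = 0ℤ
nth (v ∷ vs) zero    = v
nth (v ∷ vs) (suc y) = nth vs y

set : ℕ → ℤ → List ℤ → List ℤ
set zero    v []       = v ∷ []
set zero    v (_ ∷ us) = v ∷ us
set (suc y) v []       = 0ℤ ∷ set y v []
set (suc y) v (u ∷ us) = u ∷ set y v us

nth-set : ∀ y v us z → (if y ≡ᵇ z then v else nth us z) ≡ nth (set y v us) z
nth-set zero    v []       zero    = refl
nth-set zero    v []       (suc z) = refl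
nth-set zero    v (u ∷ us) zero    = refl
nth-set zero    v (u ∷ us) (suc z) = refl
nth-set (suc y) v []       zero    = refl
nth-set (suc y) v []       (suc z) = nth-set y v [] z
nth-set (suc y) v (u ∷ us) zero    = refl
nth-set (suc y) v (u ∷ us) (suc z) = nth-set y v us z

-- A state in which only array 0 is in use, and in which this array is filled
-- from position 0 on.  Unlike states, configurations have a normal form.
record Config : Set where
  constructor ⟪_,_,_⟫
  field
    regs tape out : List ℤ

open Config public

arrays : List ℤ → ℕ → ℤ → ℤ
arrays l zero    = cells l
arrays l (suc _) = λ _ → 0ℤ

infix 4 _≈_

record _≈_ (s : State) (c : Config) : Set where
  constructor mk≈
  field
    register≈ : ∀ y → register s y ≡ nth (regs c) y
    memory≈   : ∀ a i → memory s a i ≡ arrays (tape c) a i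
    output≈   : output s ≡ out c

open _≈_

module Logic (x : Real) where
  open Semantics x public

  ⟦_⟧ : Expr → Config → ℤ
  ⟦ lit v ⟧   c = v
  ⟦ var y ⟧   c = nth (regs c) y
  ⟦ d ⊕ e ⟧   c = ⟦ d ⟧ c ℤ.+ ⟦ e ⟧ c
  ⟦ d ⊖ e ⟧   c = ⟦ d ⟧ c ℤ.- ⟦ e ⟧ c
  ⟦ arr a e ⟧ c = arrays (tape c) a (⟦ e ⟧ c)
  ⟦ real e ⟧  c = approx x ∣ ⟦ e ⟧ c ∣

  ⟦_⟧ᵗ : Test → Config → Bool
  ⟦ d ≼ e ⟧ᵗ c = ⟦ d ⟧ c ℤ.≤ᵇ ⟦ e ⟧ c

  eval-≈ : ∀ e {s c} → s ≈ c → eval e s ≡ ⟦ e ⟧ c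
  eval-≈ (lit v)   p = refl
  eval-≈ (var y)   p = register≈ p y
  eval-≈ (d ⊕ e)   p = cong₂ ℤ._+_ (eval-≈ d p) (eval-≈ e p)
  eval-≈ (d ⊖ e)   p = cong₂ ℤ._-_ (eval-≈ d p) (eval-≈ e p)
  eval-≈ (arr a e) {s} p = trans (cong (memory s a) (eval-≈ e p)) (memory≈ p a _)
  eval-≈ (real e)  p = cong (λ v → approx x ∣ v ∣) (eval-≈ e p)

  evalᵗ-≈ : ∀ b {s c} → s ≈ c → evalᵗ b s ≡ ⟦ b ⟧ᵗ c
  evalᵗ-≈ (d ≼ e) p = cong₂ ℤ._≤ᵇ_ (eval-≈ d p) (eval-≈ e p)

  -- The number of steps is only bounded by `T`, so that branches and rounds of different cost fit
  -- one specification. Being a record, it lets its indices be inferred by unification.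
  record Exec (p : Program) (c : Config) (T : ℕ) (Q : Config → Set) : Set where
    constructor exec
    field
      run : ∀ {s} → s ≈ c →
        Σ ℕ λ t → Σ State λ s′ → Σ Config λ c′ →
          (⟨ p , s ⟩⇓[ t ] s′) × t ≤ T × s′ ≈ c′ × Q c′

  open Exec public

  consequence : ∀ {p c T U} {Q R : Config → Set} → Exec p c T Q →
    (∀ {c′} → Q c′ → R c′) → T ≤ U → Exec p c U R
  consequence E f T≤U = exec λ e → let t , s′ , c′ , r , t≤T , e′ , q = run E e in
    t , s′ , c′ , r , ℕ.≤-trans t≤T T≤U , e′ , f q

  exec-≔ : ∀ {c y e} {Q : Config → Set} →
    Q ⟪ set y (⟦ e ⟧ c) (regs c) , tape c , out c ⟫ →
    Exec (y ≔ e) c (1 + cost e) Q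
  exec-≔ {c} {y} {e} q = exec λ {s} p →
    _ , _ , _ , ⇓≔ , ℕ.≤-refl , mk≈ (r p) (memory≈ p) (output≈ p) , q
    where
    r : ∀ {s} → s ≈ c → ∀ z →
      (if y ≡ᵇ z then eval e s else register s z) ≡ nth (set y (⟦ e ⟧ c) (regs c)) z
    r p z rewrite eval-≈ e p | register≈ p z = nth-set y (⟦ e ⟧ c) (regs c) z

  -- Writes are confined to the first free cell, which is what keeps the memory presentable as a
  -- list.
  exec-write : ∀ {c d e} {Q : Config → Set} → ⟦ d ⟧ c ≡ + length (tape c) →
    Q ⟪ regs c , tape c ∷ʳ ⟦ e ⟧ c , out c ⟫ →
    Exec (0 [ d ]≔ e) c (1 + cost d + cost e) Q
  exec-write {c} {d} {e} d≡ q = exec λ {s} p →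
    _ , _ , _ , ⇓[]≔ , ℕ.≤-refl , mk≈ (register≈ p) (r p) (output≈ p) , q
    where
    r : ∀ {s} → s ≈ c → ∀ a i →
      (if 0 ≡ᵇ a then (if eval d s ≡ᵇℤ i then eval e s else memory s a i) else memory s a i)
        ≡ arrays (tape c ∷ʳ ⟦ e ⟧ c) a i
    r p (suc a) i = memory≈ p (suc a) i
    r p zero    i rewrite eval-≈ d p | d≡ | eval-≈ e p | memory≈ p 0 i =
      cells-∷ʳ (tape c) (⟦ e ⟧ c) i

  exec-print : ∀ {c e} {Q : Config → Set} →
    Q ⟪ regs c , tape c , out c ∷ʳ ⟦ e ⟧ c ⟫ → Exec (print e) c (1 + cost e) Q
  exec-print {c} {e} q = exec λ p → _ , _ , _ , ⇓print , ℕ.≤-refl ,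
    mk≈ (register≈ p) (memory≈ p) (cong₂ _∷ʳ_ (output≈ p) (eval-≈ e p)) , q

  exec-≔′ : ∀ {c y e v} {Q : Config → Set} → ⟦ e ⟧ c ≡ v →
    Q ⟪ set y v (regs c) , tape c , out c ⟫ → Exec (y ≔ e) c (1 + cost e) Q
  exec-≔′ refl = exec-≔

  exec-print′ : ∀ {c e v} {Q : Config → Set} → ⟦ e ⟧ c ≡ v →
    Q ⟪ regs c , tape c , out c ∷ʳ v ⟫ → Exec (print e) c (1 + cost e) Q
  exec-print′ refl = exec-print

  -- The postcondition of `p` is the specification of `q`. Sequences are thus verified in
  -- continuation style: intermediate configurations are computed rather than written down.
  exec-⨾ : ∀ {p q c T U} {R : Config → Set} →
    Exec p c T (λ c′ → Exec q c′ U R) → Exec (p ⨾ q) c (T + U) R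
  exec-⨾ E = exec λ e →
    let t , s′ , c′ , r , t≤T , e′ , F = run E e
        u , s″ , c″ , r′ , u≤U , e″ , q = run F e′
    in _ , _ , _ , ⇓⨾ r r′ , ℕ.+-mono-≤ t≤T u≤U , e″ , q

  exec-true : ∀ {b p q c T} {Q : Config → Set} → ⟦ b ⟧ᵗ c ≡ true →
    Exec p c T Q → Exec (ifte b p q) c (costᵗ b + T) Q
  exec-true {b} b≡ E = exec λ e → let t , s′ , c′ , r , t≤T , rest = run E e in
    _ , _ , _ , ⇓if-true (trans (evalᵗ-≈ b e) b≡) r , ℕ.+-monoʳ-≤ (costᵗ b) t≤T , rest

  exec-false : ∀ {b p q c T} {Q : Config → Set} → ⟦ b ⟧ᵗ c ≡ false →
    Exec q c T Q → Exec (ifte b p q) c (costᵗ b + T) Q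
  exec-false {b} b≡ E = exec λ e → let t , s′ , c′ , r , t≤T , rest = run E e in
    _ , _ , _ , ⇓if-false (trans (evalᵗ-≈ b e) b≡) r , ℕ.+-monoʳ-≤ (costᵗ b) t≤T , rest

  -- The index `k` of the invariant is a budget for the rounds still to come. Since `exit` is
  -- possible at every `k`, an upper bound on the number of rounds is enough.
  data Iteration (b : Test) (p : Program) (T : ℕ) (Inv : ℕ → Config → Set)
                 (Q : Config → Set) : ℕ → Config → Set where
    exit : ∀ {k c} → ⟦ b ⟧ᵗ c ≡ false → Q c → Iteration b p T Inv Q k c
    step : ∀ {k c} → ⟦ b ⟧ᵗ c ≡ true → Exec p c T (Inv k) →
           Iteration b p T Inv Q (suc k) c

  exec-while : ∀ {b p T Q} (Inv : ℕ → Config → Set) →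
    (∀ {k c} → Inv k c → Iteration b p T Inv Q k c) →
    ∀ {k c} → Inv k c → Exec (while b p) c (k * (costᵗ b + T) + costᵗ b) Q
  exec-while {b} {p} {T} {Q} Inv body i = exec (go i)
    where
    B = costᵗ b
    go : ∀ {k c} → Inv k c → ∀ {s} → s ≈ c →
      Σ ℕ λ t → Σ State λ s′ → Σ Config λ c′ →
        (⟨ while b p , s ⟩⇓[ t ] s′) × t ≤ k * (B + T) + B × s′ ≈ c′ × Q c′
    go {k} i e with body i
    ... | exit b≡ q = _ , _ , _ , ⇓while-false (trans (evalᵗ-≈ b e) b≡) ,
                      ℕ.m≤n+m B (k * (B + T)) , e , q
    ... | step {k = k′} b≡ E with run E e
    ...   | t , s′ , c′ , r , t≤T , e′ , i′ with go i′ e′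
    ...     | u , s″ , c″ , r′ , u≤ , rest =
      _ , _ , _ , ⇓while-true (trans (evalᵗ-≈ b e) b≡) r r′ , bound , rest
      where
      open ℕ.≤-Reasoning
      bound : B + (t + u) ≤ B + T + k′ * (B + T) + B
      bound = begin
        B + (t + u)                    ≤⟨ ℕ.+-monoʳ-≤ B (ℕ.+-mono-≤ t≤T u≤) ⟩
        B + (T + (k′ * (B + T) + B))   ≡⟨ ℕ.+-assoc B T _ ⟨
        B + T + (k′ * (B + T) + B)     ≡⟨ ℕ.+-assoc (B + T) _ B ⟨
        B + T + k′ * (B + T) + B       ∎

-- Choosing the block length

≤ᵇ-true : ∀ {i j} → i ℤ.≤ j → (i ℤ.≤ᵇ j) ≡ true
≤ᵇ-true i≤j = Equivalence.to T-≡ (ℤ.≤⇒≤ᵇ i≤j)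

≤ᵇ-false : ∀ {i j} → ¬ i ℤ.≤ j → (i ℤ.≤ᵇ j) ≡ false
≤ᵇ-false {i} {j} i≰j with i ℤ.≤ᵇ j in eq
... | false = refl
... | true  = contradiction (ℤ.≤ᵇ⇒≤ (Equivalence.from T-≡ eq)) i≰j

+≤ᵇ+ : ∀ {m n} → m ≤ n → (+ m ℤ.≤ᵇ + n) ≡ true
+≤ᵇ+ m≤n = ≤ᵇ-true (+≤+ m≤n)

+≰ᵇ+ : ∀ {m n} → n < m → (+ m ℤ.≤ᵇ + n) ≡ false
+≰ᵇ+ {m} {n} n<m = ≤ᵇ-false {+ m} {+ n} λ { (+≤+ m≤n) → ℕ.<⇒≱ n<m m≤n }

double : Program
double = while (var 2 ≼ var 0) (2 ≔ var 2 ⊕ var 2 ⨾ 3 ≔ lit (+ 2) ⊕ var 3)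

split : Program
split = while (real (lit (+ 1) ⊕ var 4) ≼ var 3 ⊖ lit (+ 2))
  (4 ≔ lit (+ 1) ⊕ var 4 ⨾ 3 ≔ var 3 ⊖ lit (+ 2) ⨾ 5 ≔ var 5 ⊕ var 5)

push : Expr → Program
push e = 0 [ var 1 ]≔ e ⨾ 1 ≔ lit (+ 1) ⊕ var 1

pad : Program
pad = while (lit (+ 1) ⊕ var 1 ≼ var 2) (push (arr 0 (lit (+ 0))))

-- Registers: n = length of the input, e = end of the tape, N = 2 ^ (m + j) the
-- padded length, d = 2 j, B = 2 ^ m the block length, s = start of the data to
-- be processed, and, after `pad`, w = the length of a run resp. the offset
-- between the blocks a and b, f = end of a pass, and i, j, h, g = pointers.
file : (n e N d m B s w f i j h g : ℕ) → List ℤ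
file n e N d m B s w f i j h g =
  + n ∷ + e ∷ + N ∷ + d ∷ + m ∷ + B ∷ + s ∷ + w ∷ + f ∷ + i ∷ + j ∷ + h ∷ + g ∷ []

2^suc : ∀ k → 2 ^ suc k ≡ 2 ^ k + 2 ^ k
2^suc k = cong (λ r → 2 ^ k + r) (ℕ.+-identityʳ (2 ^ k))

-- Correctness of doubling, splitting and padding

module Setup (x : Real) where
  open Logic x

  data Doubling (n ℓ : ℕ) (t : List ℤ) : ℕ → Config → Set where
    mk : ∀ {k i N d} → N ≡ 2 ^ i → d ≡ i * 2 → i + k ≡ suc ℓ →
      Doubling n ℓ t k ⟪ file n n N d 0 0 0 0 0 0 0 0 0 , t , [] ⟫

  exec-double : ∀ {n ℓ t} → 2 ^ ℓ ≤ n → n < 2 ^ suc ℓ →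
    Exec double ⟪ file n n 1 0 0 0 0 0 0 0 0 0 0 , t , [] ⟫ (suc ℓ * 11 + 3)
      (_≡ ⟪ file n n (2 ^ suc ℓ) (suc ℓ * 2) 0 0 0 0 0 0 0 0 0 , t , [] ⟫)
  exec-double {n} {ℓ} {t} lower upper =
    exec-while (Doubling n ℓ t) body (mk {i = 0} refl refl refl)
    where
    body : ∀ {k c} → Doubling n ℓ t k c → Iteration _ _ 8 (Doubling n ℓ t) _ k c
    body {zero} (mk {i = i} refl refl i≡) with trans (sym (ℕ.+-identityʳ i)) i≡
    ... | refl = exit (+≰ᵇ+ upper) refl
    body {suc k} (mk {i = i} refl refl i≡) = step
      (+≤ᵇ+ (ℕ.≤-trans (ℕ.^-monoʳ-≤ 2 i≤ℓ) lower))
      (exec-⨾ (exec-≔ (exec-≔ (mk {i = suc i} (sym (2^suc i)) refl i+k≡))))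
      where
      i+k≡ : suc i + k ≡ suc ℓ
      i+k≡ = trans (sym (ℕ.+-suc i k)) i≡
      i≤ℓ : i ≤ ℓ
      i≤ℓ = ℕ.≤-trans (ℕ.m≤m+n i k) (ℕ.≤-reflexive (ℕ.suc-injective i+k≡))

  -- The test of `split`, made one step ahead: `j * 2 - 2` is twice the next `j`, so a step is taken
  -- only if the approximation at the next `m` is at most twice the next `j`.
  Continue : ℕ → ℕ → Set
  Continue m j = approx x (suc m) ℤ.≤ + (j * 2) ℤ.- + 2

  -- The course of the loop `split`, which turns 2 ^ j blocks of length 2 ^ m into
  -- 2 ^ j′ blocks of length 2 ^ m′.
  data Descent : (m j m′ j′ : ℕ) → Set where
    stop : ∀ {m j} → ¬ Continue m j → Descent m j m j
    next : ∀ {m j m′ j′} → Continue m (suc j) → Descent (suc m) j m′ j′ →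
           Descent m (suc j) m′ j′

  -- At `j` = 0 the test compares an approximation with -2 and fails by hypothesis. So the loop ends
  -- before a single block would have to be halved, and recursion on `j` is enough.
  descend : (∀ k → ¬ approx x k ℤ.≤ -[1+ 1 ]) → ∀ m j → ∃[ m′ ] ∃[ j′ ] Descent m j m′ j′
  descend low m zero = m , zero , stop (low (suc m))
  descend low m (suc j) with approx x (suc m) ℤ.≤? (+ (suc j * 2) ℤ.- + 2)
  ... | no ¬p = m , suc j , stop ¬p
  ... | yes p with descend low (suc m) j
  ...   | m′ , j′ , d = m′ , j′ , next p d

  data Splitting (n N m′ j′ : ℕ) (t : List ℤ) : ℕ → Config → Set where
    mk : ∀ {j m B d} → B ≡ 2 ^ m → d ≡ j * 2 → Descent m j m′ j′ →
      Splitting n N m′ j′ t j ⟪ file n n N d m B 0 0 0 0 0 0 0 , t , [] ⟫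

  exec-split : ∀ {n N L m j t} → Descent 0 L m j →
    Exec split ⟪ file n n N (L * 2) 0 1 0 0 0 0 0 0 0 , t , [] ⟫ (L * 20 + 8)
      (_≡ ⟪ file n n N (j * 2) m (2 ^ m) 0 0 0 0 0 0 0 , t , [] ⟫)
  exec-split {n} {N} {L} {m′} {j′} {t} D =
    exec-while (Splitting n N m′ j′ t) body (mk refl refl D)
    where
    body : ∀ {j c} → Splitting n N m′ j′ t j c → Iteration _ _ 12 (Splitting n N m′ j′ t) _ j c
    body (mk refl refl (stop ¬p))           = exit (≤ᵇ-false ¬p) refl
    body (mk {m = m} refl refl (next p d)) = step (≤ᵇ-true p)
      (exec-⨾ (exec-≔ (exec-⨾ (exec-≔ (exec-≔ (mk (sym (2^suc m)) refl d))))))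

  exec-push : ∀ {c e u} {Q : Config → Set} → nth (regs c) 1 ≡ + length (tape c) → ⟦ e ⟧ c ≡ u →
    Q ⟪ set 1 (+ 1 ℤ.+ nth (regs c) 1) (regs c) , tape c ∷ʳ u , out c ⟫ →
    Exec (push e) c (6 + cost e) Q
  exec-push {e = e} l≡ refl q = consequence (exec-⨾ (exec-write l≡ (exec-≔ q)))
    id (ℕ.≤-reflexive (ℕ.+-comm (2 + cost e) 4))

  data Padding (n N d m B : ℕ) (a : ℤ) (xs : List ℤ) : ℕ → Config → Set where
    mk : ∀ {k e r} → e ≡ length (a ∷ xs ++ r) → e + k ≡ N → All (_≡ a) r →
      Padding n N d m B a xs k ⟪ file n e N d m B 0 0 0 0 0 0 0 , a ∷ xs ++ r , [] ⟫

  data Padded (n N d m B : ℕ) (a : ℤ) (xs : List ℤ) : Config → Set where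
    mk : ∀ {r} → length (a ∷ xs ++ r) ≡ N → All (_≡ a) r →
      Padded n N d m B a xs ⟪ file n N N d m B 0 0 0 0 0 0 0 , a ∷ xs ++ r , [] ⟫

  exec-pad : ∀ {n N d m B a xs k} → n ≡ length (a ∷ xs) → n + k ≡ N →
    Exec pad ⟪ file n n N d m B 0 0 0 0 0 0 0 , a ∷ xs , [] ⟫ (k * 13 + 5)
      (Padded n N d m B a xs)
  exec-pad {n} {N} {d} {m} {B} {a} {xs} {k} refl k≡ =
    exec-while (Padding n N d m B a xs) body start
    where
    at : ℕ → List ℤ → Config
    at e l = ⟪ file n e N d m B 0 0 0 0 0 0 0 , a ∷ l , [] ⟫
    start : Padding n N d m B a xs k (at n xs)
    start = subst (λ l → Padding n N d m B a xs k (at n l)) (++-identityʳ xs)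
      (mk (cong (λ l → suc (length l)) (sym (++-identityʳ xs))) k≡ [])
    body : ∀ {k c} → Padding n N d m B a xs k c → Iteration _ _ 8 (Padding n N d m B a xs) _ k c
    body {zero} (mk {e = e} {r = r} refl e≡ as) with trans (sym (ℕ.+-identityʳ e)) e≡
    ... | refl = exit (+≰ᵇ+ {suc e} ℕ.≤-refl) (mk refl as)
    body {suc k} (mk {e = e} {r = r} refl e≡ as) = step
      (+≤ᵇ+ (ℕ.≤-trans (ℕ.m≤m+n (suc e) k) (ℕ.≤-reflexive e+k≡)))
      (exec-push refl refl
        (subst (λ l → Padding n N d m B a xs k (at (suc e) l)) (sym (++-assoc xs r (a ∷ [])))
        (mk len e+k≡ (All.++⁺ as (refl ∷ [])))))
      where
      e+k≡ : suc e + k ≡ N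
      e+k≡ = trans (sym (ℕ.+-suc e k)) e≡
      len : suc e ≡ length (a ∷ xs ++ (r ∷ʳ a))
      len = sym (trans (cong (λ l → suc (length l)) (sym (++-assoc xs r (a ∷ []))))
                (cong suc (trans (length-++ (xs ++ r)) (ℕ.+-comm (length (xs ++ r)) 1))))

-- Merge sort

Segment-∷ʳ : ∀ {l} a zs v → Segment l a zs → a + length zs ≡ length l →
  Segment (l ∷ʳ v) a (zs ∷ʳ v)
Segment-∷ʳ {l} a zs v s eq = Segment-join a zs (Segment-++ [ v ] zs s)
  (subst (λ b → At (l ∷ʳ v) b v) (sym eq) (At-length l) , tt)

length-∷ʳ : ∀ {X : Set} (l : List X) v → length (l ∷ʳ v) ≡ suc (length l)
length-∷ʳ l v = trans (length-++ l) (ℕ.+-comm (length l) 1)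

_⋈_ : List ℤ → List ℤ → List ℤ
_⋈_ = merge ℤ._≤?_

-- The machine branches on `≤ᵇ` and the library's `merge` on `≤?`; they agree by computation only
-- once the signs are known.
does-≤? : ∀ x y → does (x ℤ.≤? y) ≡ (x ℤ.≤ᵇ y)
does-≤? (+ m)    (+ n)    = refl
does-≤? (+ m)    -[1+ n ] = refl
does-≤? -[1+ m ] (+ n)    = refl
does-≤? -[1+ m ] -[1+ n ] = refl

⋈-true : ∀ {x y} xs ys → (x ℤ.≤ᵇ y) ≡ true → ((x ∷ xs) ⋈ (y ∷ ys)) ≡ x ∷ (xs ⋈ (y ∷ ys))
⋈-true {x} {y} xs ys eq rewrite does-≤? x y | eq = refl

⋈-false : ∀ {x y} xs ys → (x ℤ.≤ᵇ y) ≡ false → ((x ∷ xs) ⋈ (y ∷ ys)) ≡ y ∷ ((x ∷ xs) ⋈ ys)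
⋈-false {x} {y} xs ys eq rewrite does-≤? x y | eq = refl

⋈-[] : ∀ xs → (xs ⋈ []) ≡ xs
⋈-[] []       = refl
⋈-[] (_ ∷ _) = refl

takeLeft takeRight mergeStep mergeRuns pass sort : Program
takeLeft  = push (arr 0 (var 9)) ⨾ 9 ≔ lit (+ 1) ⊕ var 9
takeRight = push (arr 0 (var 10)) ⨾ 10 ≔ lit (+ 1) ⊕ var 10

mergeStep =
  ifte (var 6 ≼ var 10) takeLeft
    (ifte (var 11 ≼ var 9) takeRight
      (ifte (arr 0 (var 9) ≼ arr 0 (var 10)) takeLeft takeRight))

mergeRuns =
  -- Register 6 is moved past both runs before merging starts: it is then the end of the right run
  -- as well as the start of the remaining queue. Register 12 is the length of the tape once both
  -- runs are copied.
  9 ≔ var 6 ⨾ 10 ≔ var 6 ⊕ var 7 ⨾ 11 ≔ var 10 ⨾ 6 ≔ var 10 ⊕ var 7 ⨾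
  12 ≔ var 1 ⊕ (var 7 ⊕ var 7) ⨾
  while (lit (+ 1) ⊕ var 1 ≼ var 12) mergeStep

pass = 8 ≔ var 1 ⨾ while (lit (+ 1) ⊕ var 6 ≼ var 8) mergeRuns

sort = 7 ≔ lit (+ 1) ⨾ while (lit (+ 1) ⊕ var 7 ≼ var 2) (pass ⨾ 7 ≔ var 7 ⊕ var 7)

+-length₂ : ∀ {w} s (xs ys zs : List ℤ) → length xs ≡ w → length ys ≡ w →
  s + w + w + length zs ≡ s + length (xs ++ ys ++ zs)
+-length₂ s xs ys zs refl yw = begin
  s + length xs + length xs + length zs     ≡⟨ cong (λ a → s + length xs + a + length zs) yw ⟨
  s + length xs + length ys + length zs     ≡⟨ ℕ.+-assoc (s + length xs) (length ys) _ ⟩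
  s + length xs + (length ys + length zs)   ≡⟨ ℕ.+-assoc s (length xs) _ ⟩
  s + (length xs + (length ys + length zs)) ≡⟨ cong (λ a → s + (length xs + a)) (length-++ ys) ⟨
  s + (length xs + length (ys ++ zs))       ≡⟨ cong (s ℕ.+_) (length-++ xs) ⟨
  s + length (xs ++ ys ++ zs)               ∎
  where open ≡-Reasoning

Run : ℕ → List ℤ → Set
Run w r = length r ≡ w × Sorted r

⋈-run : ∀ {w xs ys} → Run w xs → Run w ys → Run (w + w) (xs ⋈ ys)
⋈-run {xs = xs} {ys} (xw , xs↗) (yw , ys↗) =
  trans (↭-length (merge-↭ ℤ._≤?_ xs ys)) (trans (length-++ xs) (cong₂ _+_ xw yw)) ,
  Sorted.merge⁺ ℤ.≤-decTotalOrder xs↗ ys↗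

concat-∷ʳ : ∀ (ls : List (List ℤ)) l → concat (ls ∷ʳ l) ≡ concat ls ++ l
concat-∷ʳ ls l = trans (sym (concat-++ ls [ l ])) (cong (concat ls ++_) (++-identityʳ l))

-- Correctness and running time of the sort

module Sort (x : Real) where
  open Logic x
  open Setup x using (exec-push)

  module _ {n N d m B s w f h g : ℕ} {target : List ℤ} where

    -- Here `zs` is all that is stored from `s` on, the untouched rest of the queue followed by the
    -- numbers merged so far. Hence each number taken is appended to `zs`, while `zs ++ (xs ⋈ ys)`
    -- stays equal to `target`.
    data Merging (k : ℕ) : Config → Set where
      mk : ∀ {e i j l} xs ys zs → e ≡ length l →
        Segment l i xs → i + length xs ≡ h →
        Segment l j ys → j + length ys ≡ s →
        Segment l s zs → s + length zs ≡ e →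
        e + k ≡ g → k ≡ length xs + length ys → zs ++ (xs ⋈ ys) ≡ target →
        Merging k ⟪ file n e N d m B s w f i j h g , l , [] ⟫

    data Merged : Config → Set where
      mk : ∀ {i j l} → g ≡ length l → Segment l s target → s + length target ≡ g →
        Merged ⟪ file n g N d m B s w f i j h g , l , [] ⟫

    exec-takeLeft : ∀ {e i j l k v} xs ys zs → e ≡ length l →
      Segment l i (v ∷ xs) → i + suc (length xs) ≡ h →
      Segment l j ys → j + length ys ≡ s →
      Segment l s zs → s + length zs ≡ e →
      e + suc k ≡ g → suc k ≡ suc (length xs) + length ys → zs ++ v ∷ (xs ⋈ ys) ≡ target →
      Exec takeLeft ⟪ file n e N d m B s w f i j h g , l , [] ⟫ 12 (Merging k)
    exec-takeLeft {e} {i} {j} {l} {k} {v} xs ys zs refl (p , sx) ix sy jy sz ez eg kk tt≡ =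
      exec-⨾ (exec-push refl (At-cells p) (exec-≔
        (mk xs ys (zs ∷ʳ v) (sym (length-∷ʳ l v))
          (Segment-++ [ v ] xs sx) (trans (sym (ℕ.+-suc i _)) ix)
          (Segment-++ [ v ] ys sy) jy
          (Segment-∷ʳ s zs v sz ez)
            (trans (cong (s ℕ.+_) (length-∷ʳ zs v)) (trans (ℕ.+-suc s _) (cong suc ez)))
          (trans (sym (ℕ.+-suc e k)) eg) (ℕ.suc-injective kk)
          (trans (++-assoc zs [ v ] _) tt≡))))

    exec-takeRight : ∀ {e i j l k v} xs ys zs → e ≡ length l →
      Segment l i xs → i + length xs ≡ h →
      Segment l j (v ∷ ys) → j + suc (length ys) ≡ s →
      Segment l s zs → s + length zs ≡ e →
      e + suc k ≡ g → suc k ≡ length xs + suc (length ys) → zs ++ v ∷ (xs ⋈ ys) ≡ target →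
      Exec takeRight ⟪ file n e N d m B s w f i j h g , l , [] ⟫ 12 (Merging k)
    exec-takeRight {e} {i} {j} {l} {k} {v} xs ys zs refl sx ix (p , sy) jy sz ez eg kk tt≡ =
      exec-⨾ (exec-push refl (At-cells p) (exec-≔
        (mk xs ys (zs ∷ʳ v) (sym (length-∷ʳ l v))
          (Segment-++ [ v ] xs sx) ix
          (Segment-++ [ v ] ys sy) (trans (sym (ℕ.+-suc j _)) jy)
          (Segment-∷ʳ s zs v sz ez)
            (trans (cong (s ℕ.+_) (length-∷ʳ zs v)) (trans (ℕ.+-suc s _) (cong suc ez)))
          (trans (sym (ℕ.+-suc e k)) eg) (ℕ.suc-injective (trans kk (ℕ.+-suc (length xs) _)))
          (trans (++-assoc zs [ v ] _) tt≡))))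

    private
      <-from : ∀ {a b c} → a + suc b ≡ c → a < c
      <-from {a} {b} refl = ℕ.m<m+n a (s≤s z≤n)
      ≡-from : ∀ {a c} → a + 0 ≡ c → c ≤ a
      ≡-from {a} refl = ℕ.≤-reflexive (ℕ.+-identityʳ a)

    merging-body : ∀ {k c} → Merging k c →
      Iteration (lit (+ 1) ⊕ var 1 ≼ var 12) mergeStep 23 Merging Merged k c
    merging-body (mk {e} [] [] zs e≡ sx ix sy jy sz ez eg refl t≡)
      with trans (sym (ℕ.+-identityʳ e)) eg | trans (sym (++-identityʳ zs)) t≡
    ... | refl | refl = exit (+≰ᵇ+ {suc e} ℕ.≤-refl) (mk e≡ sz ez)
    merging-body {k} (mk {e} [] (y ∷ ys) zs e≡ sx ix sy jy sz ez eg refl t≡) =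
      step (+≤ᵇ+ (<-from eg))
        (consequence (exec-false (+≰ᵇ+ (<-from jy)) (exec-true (+≤ᵇ+ (≡-from ix))
          (exec-takeRight [] ys zs e≡ sx ix sy jy sz ez eg refl t≡)))
          id (ℕ.m≤m+n 18 5))
    merging-body (mk {e} (x ∷ xs) [] zs e≡ sx ix sy jy sz ez eg refl t≡) =
      step (+≤ᵇ+ (<-from eg))
        (consequence (exec-true (+≤ᵇ+ (≡-from jy))
          (exec-takeLeft xs [] zs e≡ sx ix sy jy sz ez eg refl
            (trans (cong (λ r → zs ++ x ∷ r) (⋈-[] xs)) t≡)))
          id (ℕ.m≤m+n 15 8))
    merging-body (mk {e} {i} {j} {l} (x ∷ xs) (y ∷ ys) zs e≡ sx ix sy jy sz ez eg refl t≡) =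
      step (+≤ᵇ+ (<-from eg))
        (exec-false (+≰ᵇ+ (<-from jy)) (exec-false (+≰ᵇ+ (<-from ix)) compare))
      where
      test≡ : (cells l (+ i) ℤ.≤ᵇ cells l (+ j)) ≡ (x ℤ.≤ᵇ y)
      test≡ = cong₂ ℤ._≤ᵇ_ (At-cells (proj₁ sx)) (At-cells (proj₁ sy))
      compare : Exec (ifte (arr 0 (var 9) ≼ arr 0 (var 10)) takeLeft takeRight)
        ⟪ file n e N d m B s w f i j h g , l , [] ⟫ 17 (Merging (length xs + suc (length ys)))
      compare with x ℤ.≤ᵇ y in x≤y
      ... | true  = exec-true (trans test≡ x≤y)
        (exec-takeLeft xs (y ∷ ys) zs e≡ sx ix sy jy sz ez eg refl
          (trans (cong (zs ++_) (sym (⋈-true xs ys x≤y))) t≡))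
      ... | false = exec-false (trans test≡ x≤y)
        (exec-takeRight (x ∷ xs) ys zs e≡ sx ix sy jy sz ez eg refl
          (trans (cong (zs ++_) (sym (⋈-false xs ys x≤y))) t≡))

  -- Array 0 is used as a queue: the runs to be merged are read at s, and the
  -- merged runs are appended at the end.
  data Queue (n N d m B w f : ℕ) (q : List ℤ) : Config → Set where
    mk : ∀ {e s i j h g l} → e ≡ length l → Segment l s q → s + length q ≡ e →
      Queue n N d m B w f q ⟪ file n e N d m B s w f i j h g , l , [] ⟫

  mergeCost : ℕ → ℕ
  mergeCost w = 18 + ((w + w) * 28 + 5)

  exec-mergeRuns : ∀ {n N d m B w f e s i j h g l} xs ys zs →
    length xs ≡ w → length ys ≡ w →
    e ≡ length l → Segment l s (xs ++ ys ++ zs) → s + length (xs ++ ys ++ zs) ≡ e →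
    Exec mergeRuns ⟪ file n e N d m B s w f i j h g , l , [] ⟫ (mergeCost w)
      λ c → Queue n N d m B w f (zs ++ (xs ⋈ ys)) c × nth (regs c) 6 ≡ + (s + w + w)
  exec-mergeRuns {n} {N} {d} {m} {B} {w} {f} {e} {s} {l = l} xs ys zs xw yw e≡ seg len
    with Segment-split s xs seg
  ... | sx , seg′ with Segment-split (s + length xs) ys seg′
  ...   | sy , sz rewrite xw =
    consequence
      (exec-⨾ (exec-≔ (exec-⨾ (exec-≔ (exec-⨾ (exec-≔ (exec-⨾ (exec-≔ (exec-⨾ (exec-≔
        (exec-while (Merging {target = zs ++ (xs ⋈ ys)}) merging-body
          (mk xs ys zs e≡ sx (cong (s ℕ.+_) xw) sy (cong (s + w ℕ.+_) yw)
            (subst (λ b → Segment l b zs) (cong (s + w ℕ.+_) yw) sz) len′ refl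
              (sym (cong₂ _+_ xw yw)) refl))))))))))))
      (λ { (mk g≡ seg″ len″) → mk g≡ seg″ len″ , refl }) ℕ.≤-refl
    where
    len′ : s + w + w + length zs ≡ e
    len′ = trans (+-length₂ s xs ys zs xw yw) len

  module _ {n N d m B w f K : ℕ} {S : List ℤ} (1≤w : 1 ≤ w) where

    -- The boundary `f` separates the old runs `rs` from the runs `ds` made in this pass, which
    -- queue up behind it; the pass is over when `s` reaches `f`.
    data Passing (k : ℕ) : Config → Set where
      mk : ∀ {e s i j h g l} rs ds →
        All (Run w) rs → length rs ≡ k * 2 → s + length (concat rs) ≡ f →
        All (Run (w + w)) ds → k + length ds ≡ K →
        concat rs ++ concat ds ↭ S →
        e ≡ length l → Segment l s (concat rs ++ concat ds) →
        s + length (concat rs ++ concat ds) ≡ e →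
        Passing k ⟪ file n e N d m B s w f i j h g , l , [] ⟫

    data Passed : Config → Set where
      mk : ∀ {e s i j h g l} ds → All (Run (w + w)) ds → length ds ≡ K → concat ds ↭ S →
        e ≡ length l → Segment l s (concat ds) → s + length (concat ds) ≡ e →
        Passed ⟪ file n e N d m B s w f i j h g , l , [] ⟫

    passing-body : ∀ {k c} → Passing k c →
      Iteration (lit (+ 1) ⊕ var 6 ≼ var 8) mergeRuns (mergeCost w) Passing Passed k c
    passing-body {zero} (mk {s = s} [] ds [] rl refl Ds dl perm e≡ seg len) =
      exit (+≰ᵇ+ {suc s} (s≤s (ℕ.≤-reflexive (ℕ.+-identityʳ s)))) (mk ds Ds dl perm e≡ seg len)
    passing-body {suc k}
      (mk {s = s} (xs ∷ ys ∷ rs) ds (X ∷ Y ∷ Rs) rl sf Ds dl perm e≡ seg len) =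
      step (+≤ᵇ+ s<f)
        (consequence (exec-mergeRuns xs ys (concat rs ++ concat ds) (proj₁ X) (proj₁ Y) e≡
            (subst (Segment _ s) assoc₁ seg)
              (trans (cong (λ q → s + length q) (sym assoc₁)) len))
          (λ { (mk e≡′ seg′ len′ , refl) →
            mk rs (ds ∷ʳ (xs ⋈ ys)) Rs (ℕ.suc-injective (ℕ.suc-injective rl))
              (trans (+-length₂ s xs ys (concat rs) (proj₁ X) (proj₁ Y)) sf)
              (All.++⁺ Ds (⋈-run X Y ∷ []))
                (trans (cong (k ℕ.+_) (length-∷ʳ ds (xs ⋈ ys))) (trans (ℕ.+-suc k _) dl))
              (↭-trans (↭-reflexive (sym assoc₂)) (↭-trans perm′ perm))
              e≡′ (subst (Segment _ _) assoc₂ seg′)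
                (trans (cong (λ q → s + w + w + length q) (sym assoc₂)) len′) })
          ℕ.≤-refl)
      where
      s<f : s < f
      s<f = subst (s <_) (trans (+-length₂ s xs ys (concat rs) (proj₁ X) (proj₁ Y)) sf)
        (ℕ.≤-trans (ℕ.m<m+n s 1≤w) (ℕ.≤-trans (ℕ.m≤m+n (s + w) w) (ℕ.m≤m+n (s + w + w) _)))
      assoc₁ : concat (xs ∷ ys ∷ rs) ++ concat ds ≡ xs ++ ys ++ concat rs ++ concat ds
      assoc₁ = trans (++-assoc xs (ys ++ concat rs) (concat ds))
        (cong (xs ++_) (++-assoc ys (concat rs) (concat ds)))
      assoc₂ : (concat rs ++ concat ds) ++ (xs ⋈ ys) ≡ concat rs ++ concat (ds ∷ʳ (xs ⋈ ys))
      assoc₂ = trans (++-assoc (concat rs) (concat ds) (xs ⋈ ys))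
        (cong (concat rs ++_) (sym (concat-∷ʳ ds (xs ⋈ ys))))
      perm′ : (concat rs ++ concat ds) ++ (xs ⋈ ys) ↭ concat (xs ∷ ys ∷ rs) ++ concat ds
      perm′ = begin
        (concat rs ++ concat ds) ++ (xs ⋈ ys) ↭⟨ ++-comm (concat rs ++ concat ds) (xs ⋈ ys) ⟩
        (xs ⋈ ys) ++ concat rs ++ concat ds
          ↭⟨ ++⁺ʳ (concat rs ++ concat ds) (merge-↭ ℤ._≤?_ xs ys) ⟩
        (xs ++ ys) ++ concat rs ++ concat ds  ≡⟨ ++-assoc xs ys _ ⟩
        xs ++ ys ++ concat rs ++ concat ds    ≡⟨ assoc₁ ⟨
        concat (xs ∷ ys ∷ rs) ++ concat ds    ∎
        where open PermutationReasoning

  data Sorting (n N d m B : ℕ) (S : List ℤ) (k : ℕ) : Config → Set where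
    mk : ∀ {e s w f i j h g l} rs → All (Run w) rs → length rs ≡ 2 ^ k →
      1 ≤ w → w * 2 ^ k ≡ N → concat rs ↭ S →
      e ≡ length l → Segment l s (concat rs) → s + length (concat rs) ≡ e →
      Sorting n N d m B S k ⟪ file n e N d m B s w f i j h g , l , [] ⟫

  data SortedSegment (n N d m B : ℕ) (S : List ℤ) : Config → Set where
    mk : ∀ {e s w f i j h g l} R → Sorted R → R ↭ S →
      Segment l s R → s + length R ≡ e →
      SortedSegment n N d m B S ⟪ file n e N d m B s w f i j h g , l , [] ⟫

  sorting-body : ∀ {n N d m B S k c} → Sorting n N d m B S k c →
    Iteration (lit (+ 1) ⊕ var 7 ≼ var 2) (pass ⨾ 7 ≔ var 7 ⊕ var 7) (N * 56 + 11)
      (Sorting n N d m B S) (SortedSegment n N d m B S) k c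
  sorting-body {k = zero} (mk {w = w} (r ∷ []) ((_ , r↗) ∷ []) refl 1≤w w≡ perm e≡ seg len)
    with trans (sym (ℕ.*-identityʳ w)) w≡
  ... | refl rewrite ++-identityʳ r = exit (+≰ᵇ+ {suc w} ℕ.≤-refl) (mk r r↗ perm seg len)
  sorting-body {n} {N} {d} {m} {B} {S} {suc k} (mk {w = w} rs Rs rl 1≤w w≡ perm e≡ seg len) =
    step (+≤ᵇ+ w<N)
      (consequence (exec-⨾ (consequence (exec-⨾ (exec-≔
        (exec-while (Passing {K = 2 ^ k} {S = S} 1≤w) (passing-body 1≤w)
          (mk rs [] Rs (trans rl (ℕ.*-comm 2 (2 ^ k))) len [] (ℕ.+-identityʳ (2 ^ k))
            (↭-trans (↭-reflexive (++-identityʳ (concat rs))) perm) e≡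
            (subst (Segment _ _) (sym (++-identityʳ (concat rs))) seg)
            (trans (cong (λ q → _ + length q) (++-identityʳ (concat rs))) len)))))
        (λ { (mk ds Ds dl perm′ e≡′ seg′ len′) → exec-≔
          (mk ds Ds dl (ℕ.≤-trans 1≤w (ℕ.m≤m+n w w)) (trans ww≡ w≡) perm′ e≡′ seg′ len′) })
        ℕ.≤-refl)) id bound)
    where
    P = 2 ^ k
    ww≡ : (w + w) * P ≡ w * 2 ^ suc k
    ww≡ = trans (ℕ.*-distribʳ-+ P w w)
      (trans (sym (ℕ.*-distribˡ-+ w P P)) (cong (w ℕ.*_) (sym (2^suc k))))
    1≤P : 1 ≤ P
    1≤P = ℕ.m^n>0 2 k
    ww≤N : w + w ≤ N
    ww≤N = ℕ.≤-trans (ℕ.m≤m*n (w + w) P {{ℕ.>-nonZero 1≤P}}) (ℕ.≤-reflexive (trans ww≡ w≡))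
    w<N : w < N
    w<N = ℕ.≤-trans (ℕ.m<m+n w 1≤w) ww≤N
    P≤N : P ≤ N
    P≤N = ℕ.≤-trans (ℕ.m≤n*m P (w + w) {{ℕ.>-nonZero (ℕ.≤-trans 1≤w (ℕ.m≤m+n w w))}})
      (ℕ.≤-reflexive (trans ww≡ w≡))
    -- Each of the `P` merges costs a constant plus a multiple of `w + w`. As `(w + w) * P` is `N`
    -- and `P ≤ N`, the pass is linear in `N` whatever `w` is.
    bound : 2 + (P * (5 + mergeCost w) + 5) + 4 ≤ N * 56 + 11
    bound = begin
      2 + (P * (5 + mergeCost w) + 5) + 4 ≡⟨ solve 2 (λ P w →
          con 2 :+ (P :* (con 5 :+ (con 18 :+ ((w :+ w) :* con 28 :+ con 5))) :+ con 5) :+ con 4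
            := (P :+ (w :+ w) :* P) :* con 28 :+ con 11) refl P w ⟩
      (P + (w + w) * P) * 28 + 11         ≡⟨ cong (λ a → (P + a) * 28 + 11) (trans ww≡ w≡) ⟩
      (P + N) * 28 + 11
        ≤⟨ ℕ.+-monoˡ-≤ 11 (ℕ.*-monoˡ-≤ 28 (ℕ.+-monoˡ-≤ N P≤N)) ⟩
      (N + N) * 28 + 11
        ≡⟨ solve 1 (λ N → (N :+ N) :* con 28 :+ con 11 := N :* con 56 :+ con 11) refl N ⟩
      N * 56 + 11                         ∎
      where open ℕ.≤-Reasoning
            open +-*-Solver

  exec-sort : ∀ {n N d m B L S} → length S ≡ N → N ≡ 2 ^ L →
    Exec sort ⟪ file n N N d m B 0 0 0 0 0 0 0 , S , [] ⟫ (L * (N * 56 + 16) + 7)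
      (SortedSegment n N d m B S)
  exec-sort {n} {N} {d} {m} {B} {L} {S} refl N≡ = consequence
    (exec-⨾ (exec-≔ (exec-while (Sorting n N d m B S) sorting-body {k = L}
      (mk {w = 1} (map [_] S) (All.map⁺ (All.universal (λ v → refl , Linked.[-]) S))
        (trans (length-map [_] S) N≡) ℕ.≤-refl (trans (ℕ.*-identityˡ (2 ^ L)) (sym N≡))
        (↭-reflexive c≡) refl (subst (Segment S 0) (sym c≡) (Segment-refl S))
          (cong length c≡)))))
    id (ℕ.≤-reflexive (solve 2 (λ L N →
      con 2 :+ (L :* (con 5 :+ (N :* con 56 :+ con 11)) :+ con 5)
        := L :* (N :* con 56 :+ con 16) :+ con 7) refl L N))
    where
    open +-*-Solver
    c≡ : concat (map [_] S) ≡ S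
    c≡ = concat-map-[ S ]

-- Enumerating the triples of blocks

-- Speaking of values instead of positions makes the property depend only on which numbers occur, so
-- that sorting, padding and repeated blocks need no bookkeeping of indices.
Solvable : List ℤ → Set
Solvable l = ∃[ x ] ∃[ y ] ∃[ z ] x ∈ l × y ∈ l × z ∈ l × x ℤ.+ y ℤ.+ z ≡ 0ℤ

Yes⇒Solvable : ∀ {n} (A : Vec ℤ n) → Yes A → Solvable (toList A)
Yes⇒Solvable A (i , j , h , eq) = _ , _ , _ , at i , at j , at h , eq
  where
  at : ∀ i → lookup A i ∈ toList A
  at i = Vec.∈-toList⁺ (Vec.∈-lookup i A)

Solvable⇒Yes : ∀ {n} (A : Vec ℤ n) → Solvable (toList A) → Yes A
Solvable⇒Yes A (x , y , z , x∈ , y∈ , z∈ , eq) with position x∈ | position y∈ | position z∈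
  where
  position : ∀ {v} → v ∈ toList A → ∃[ i ] lookup A i ≡ v
  position v∈ = Vec.index p , sym (Vec.lookup-index p)
    where
    p = Vec.∈-toList⁻ v∈
... | i , refl | j , refl | h , refl = i , j , h , eq

instanceOf : List ℤ → ParamInstance
instanceOf l = length l , fromList l

serialise-instanceOf : ∀ l → serialise (instanceOf l) ≡ + length l ∷ + length l ∷ l
serialise-instanceOf l rewrite toList∘fromList l = refl

emit visit advance walk enumerate : Program
emit = print (arr 0 (var 9 ⊕ var 11)) ⨾ print (arr 0 (var 9 ⊕ var 7 ⊕ var 11)) ⨾
  print (arr 0 (var 10 ⊕ var 11)) ⨾ 11 ≔ lit (+ 1) ⊕ var 11

advance =
  ifte
    (arr 0 (var 9 ⊕ var 5 ⊖ lit (+ 1)) ⊕ arr 0 (var 9 ⊕ var 7 ⊕ var 5 ⊖ lit (+ 1))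
      ⊕ arr 0 (var 10) ≼ lit (+ 0))
    (9 ≔ var 5 ⊕ var 9)
    -- If `c` is the first block, it cannot go down. Then `a` can be left: the current triple has
    -- been output, and no lower `c` remains for this `a`.
    (ifte (var 10 ≼ var 6) (9 ≔ var 5 ⊕ var 9) (10 ≔ var 10 ⊖ var 5))

-- A serialised instance starts with its parameter and the length of its encoding. For 3-Sum both
-- are the number of entries, so the same value is printed twice.
visit = print (var 5 ⊕ var 5 ⊕ var 5) ⨾ print (var 5 ⊕ var 5 ⊕ var 5) ⨾
  11 ≔ lit (+ 0) ⨾ while (lit (+ 1) ⊕ var 11 ≼ var 5) emit ⨾ advance

walk = 9 ≔ var 6 ⨾ 10 ≔ var 1 ⊖ var 5 ⨾ while (lit (+ 1) ⊕ (var 9 ⊕ var 7) ≼ var 1) visit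

enumerate = 7 ≔ lit (+ 0) ⨾ while (lit (+ 1) ⊕ var 7 ≼ var 2) (walk ⨾ 7 ≔ var 5 ⊕ var 7)

+-cancel-⊖ : ∀ b x → + (b + x) ℤ.- + b ≡ + x
+-cancel-⊖ b x = trans (ℤ.[+m]-[+n]≡m⊖n (b + x) b)
  (trans (ℤ.⊖-≥ (ℕ.m≤m+n b x)) (cong +_ (ℕ.m+n∸m≡n b x)))

+-suc-⊖1 : ∀ p b → + (p + suc b) ℤ.- + 1 ≡ + (p + b)
+-suc-⊖1 p b = trans (cong (λ q → + q ℤ.- + 1) (ℕ.+-suc p b)) (+-cancel-⊖ 1 (p + b))

-- The blocks of a tape l are stored from s on: γ + 1 blocks of β + 1 numbers each.
module Blocks (l : List ℤ) (s β γ : ℕ) where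

  B G : ℕ
  B = suc β
  G = suc γ

  F : ℕ → ℤ
  F q = cells l (+ (s + q))

  V : ℕ → ℕ → ℤ
  V k t = F (k * B + t)

  -- The blocks are interleaved, since one offset `t` runs through all three of them in a single
  -- loop.
  entries : (a b c t n : ℕ) → List ℤ
  entries a b c t zero    = []
  entries a b c t (suc n) = V a t ∷ V b t ∷ V c t ∷ entries a b c (suc t) n

  triple : (a b c : ℕ) → List ℤ
  triple a b c = entries a b c 0 B

  length-entries : ∀ a b c t n → length (entries a b c t n) ≡ n * 3
  length-entries a b c t zero    = refl
  length-entries a b c t (suc n) = cong (3 ℕ.+_) (length-entries a b c (suc t) n)

  ∈-entries : ∀ {a b c} t n i → t ≤ i → i < t + n →
    V a i ∈ entries a b c t n × V b i ∈ entries a b c t n × V c i ∈ entries a b c t n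
  ∈-entries t zero    i t≤i i< = contradiction (subst (i <_) (ℕ.+-identityʳ t) i<) (ℕ.≤⇒≯ t≤i)
  ∈-entries t (suc n) i t≤i i< with ℕ.m≤n⇒m<n∨m≡n t≤i
  ... | inj₂ refl = here refl , there (here refl) , there (there (here refl))
  ... | inj₁ t<i with ∈-entries (suc t) n i t<i (subst (i <_) (ℕ.+-suc t n) i<)
  ...   | p , q , r =
    there (there (there p)) , there (there (there q)) , there (there (there r))

  Occurs : ℤ → Set
  Occurs v = ∃[ i ] i < G * B × v ≡ F i

  index< : ∀ {k t} → k < G → t < B → k * B + t < G * B
  index< {k} {t} k<G t<B = ℕ.<-≤-trans (ℕ.+-monoʳ-< (k * B) t<B)
    (ℕ.≤-trans (ℕ.≤-reflexive (ℕ.+-comm (k * B) B)) (ℕ.*-monoˡ-≤ B k<G))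

  entries-occur : ∀ {a b c} → a < G → b < G → c < G → ∀ t n → t + n ≤ B →
    All Occurs (entries a b c t n)
  entries-occur a< b< c< t zero    _  = []
  entries-occur a< b< c< t (suc n) tn =
    (_ , index< a< t<B , refl) ∷ (_ , index< b< t<B , refl) ∷ (_ , index< c< t<B , refl) ∷
    entries-occur a< b< c< (suc t) n tn′
    where
    tn′ : suc t + n ≤ B
    tn′ = subst (_≤ B) (ℕ.+-suc t n) tn
    t<B : t < B
    t<B = ℕ.≤-trans (ℕ.m≤m+n (suc t) n) tn′

  Sound : ParamInstance → Set
  Sound (n , J) = n ≡ B * 3 × All Occurs (toList J)

  triple-sound : ∀ {a b c} → a < G → b < G → c < G → Sound (instanceOf (triple a b c))
  triple-sound {a} {b} {c} a< b< c< = length-entries a b c 0 B ,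
    subst (All Occurs) (sym (toList∘fromList (triple a b c)))
      (entries-occur a< b< c< 0 B ℕ.≤-refl)

  Solution : (a b c : ℕ) → Set
  Solution a b c = ∃[ t ] ∃[ u ] ∃[ v ] t < B × u < B × v < B × V a t ℤ.+ V b u ℤ.+ V c v ≡ 0ℤ

  Covered : List ParamInstance → Set
  Covered = Any (λ J → Yes (proj₂ J))

  triple-yes : ∀ {a b c} → Solution a b c → Yes (proj₂ (instanceOf (triple a b c)))
  triple-yes {a} {b} {c} (t , u , v , t< , u< , v< , eq) =
    Solvable⇒Yes (fromList (triple a b c))
    (subst Solvable (sym (toList∘fromList (triple a b c)))
      (_ , _ , _ , proj₁ (∈-entries 0 B t z≤n t<) , proj₁ (proj₂ (∈-entries 0 B u z≤n u<)) ,
       proj₂ (proj₂ (∈-entries 0 B v z≤n v<)) , eq))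

  Monotone : Set
  Monotone = ∀ {i j} → i ≤ j → j < G * B → F i ℤ.≤ F j

  extremes : (a b c : ℕ) → ℤ
  extremes a b c = V a β ℤ.+ V b β ℤ.+ V c 0

  module _ (mono : Monotone) where

    V-≤-last : ∀ {a a′ t} → a ≤ a′ → a′ < G → t < B → V a t ℤ.≤ V a′ β
    V-≤-last {a} {a′} {t} a≤ a′< t< =
      mono (ℕ.+-mono-≤ (ℕ.*-monoˡ-≤ B a≤) (ℕ.≤-pred t<)) (index< a′< ℕ.≤-refl)

    V-first-≤ : ∀ {c c′ t} → c ≤ c′ → c′ < G → t < B → V c 0 ℤ.≤ V c′ t
    V-first-≤ c≤ c′< t< = mono (ℕ.+-mono-≤ (ℕ.*-monoˡ-≤ B c≤) z≤n) (index< c′< t<)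

    V-last-≤ : ∀ {a a′ t} → a < a′ → a′ < G → t < B → V a β ℤ.≤ V a′ t
    V-last-≤ {a} {a′} {t} a< a′< t< = mono (begin
      a * B + β  ≤⟨ ℕ.+-monoʳ-≤ (a * B) (ℕ.n≤1+n β) ⟩
      a * B + B  ≡⟨ ℕ.+-comm (a * B) B ⟩
      suc a * B  ≤⟨ ℕ.*-monoˡ-≤ B a< ⟩
      a′ * B     ≤⟨ ℕ.m≤m+n (a′ * B) t ⟩
      a′ * B + t ∎) (index< a′< t<)
      where open ℕ.≤-Reasoning

    V-≤-first : ∀ {c c′ t} → c < c′ → c′ < G → t < B → V c t ℤ.≤ V c′ 0
    V-≤-first {c} {c′} {t} c< c′< t< = mono (begin
      c * B + t  ≤⟨ ℕ.+-monoʳ-≤ (c * B) (ℕ.<⇒≤ t<) ⟩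
      c * B + B  ≡⟨ ℕ.+-comm (c * B) B ⟩
      suc c * B  ≤⟨ ℕ.*-monoˡ-≤ B c< ⟩
      c′ * B     ≡⟨ ℕ.+-identityʳ _ ⟨
      c′ * B + 0 ∎) (index< c′< (s≤s z≤n))
      where open ℕ.≤-Reasoning

    -- A solution in the blocks a, b and a block before c lets `extremes` be ≥ 0,
    -- and hence = 0, which makes its three summands a solution.
    drop-first : ∀ {a b c c′} → extremes a b c ℤ.≤ 0ℤ → c′ ≤ c →
      a < G → b < G → c < G → Solution a b c′ → Solution a b c
    drop-first {a} {b} {c} σ≤0 c′≤c a< b< c< (t , u , v , t< , u< , v< , eq)
      with ℕ.m≤n⇒m<n∨m≡n c′≤c
    ... | inj₂ refl = t , u , v , t< , u< , v< , eq
    ... | inj₁ c′<c = β , β , 0 , ℕ.≤-refl , ℕ.≤-refl , s≤s z≤n , ℤ.≤-antisym σ≤0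
      (ℤ.≤-trans (ℤ.≤-reflexive (sym eq))
        (ℤ.+-mono-≤ (ℤ.+-mono-≤ (V-≤-last ℕ.≤-refl a< t<) (V-≤-last ℕ.≤-refl b< u<))
          (V-≤-first c′<c c< v<)))

    -- Numbers in later blocks are at least the last numbers of `a` and `b`, and those in `c` at
    -- least its first, so every such sum is at least `extremes a b c` and hence positive.
    drop-last : ∀ {a b a′ b′ c} → ¬ extremes a b c ℤ.≤ 0ℤ → a < a′ → b < b′ →
      a′ < G → b′ < G → c < G → ¬ Solution a′ b′ c
    drop-last σ≰0 a<a′ b<b′ a′< b′< c< (t , u , v , t< , u< , v< , eq) =
      σ≰0 (ℤ.≤-trans (ℤ.+-mono-≤ (ℤ.+-mono-≤ (V-last-≤ a<a′ a′< t<) (V-last-≤ b<b′ b′< u<))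
        (V-first-≤ ℕ.≤-refl c< v<)) (ℤ.≤-reflexive eq))

-- Correctness and running time of the enumeration

module Enumeration (x : Real) where
  open Logic x

  module Triples (l : List ℤ) (s β γ : ℕ) (n N d m f g : ℕ) where
    open Blocks l s β γ

    address₁ : ∀ a t → s + a * B + t ≡ s + (a * B + t)
    address₁ a t = ℕ.+-assoc s (a * B) t

    address₂ : ∀ a δ t → s + a * B + δ * B + t ≡ s + ((a + δ) * B + t)
    address₂ a δ t = begin
      s + a * B + δ * B + t     ≡⟨ cong (_+ t) (ℕ.+-assoc s (a * B) (δ * B)) ⟩
      s + (a * B + δ * B) + t   ≡⟨ cong (λ q → s + q + t) (ℕ.*-distribʳ-+ B a δ) ⟨
      s + (a + δ) * B + t       ≡⟨ ℕ.+-assoc s ((a + δ) * B) t ⟩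
      s + ((a + δ) * B + t)     ∎
      where open ≡-Reasoning

    +-suc-+-< : ∀ {a α δ} → a + suc α + δ ≡ G → a + δ < G
    +-suc-+-< {a} {α} {δ} a≡ = subst (suc (a + δ) ≤_) a≡
      (ℕ.≤-trans (s≤s (ℕ.+-monoˡ-≤ δ (ℕ.m≤m+n a α)))
        (ℕ.≤-reflexive (cong (_+ δ) (sym (ℕ.+-suc a α)))))

    e : ℕ
    e = s + G * B

    conf : (δ a c h : ℕ) → List ℤ → Config
    conf δ a c h o = ⟪ file n e N d m B s (δ * B) f (s + a * B) (s + c * B) h g , l , o ⟫

    module _ (δ a c : ℕ) where

      data Emitting (o : List ℤ) (k : ℕ) : Config → Set where
        mk : ∀ {t o′} → t + k ≡ B → o′ ++ entries a (a + δ) c t k ≡ o →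
          Emitting o k (conf δ a c t o′)

      data Emitted (o : List ℤ) : Config → Set where
        mk : ∀ {h} → Emitted o (conf δ a c h o)

      emitting-body : ∀ {o k C} → Emitting o k C →
        Iteration (lit (+ 1) ⊕ var 11 ≼ var 5) emit 21 (Emitting o) (Emitted o) k C
      emitting-body {k = zero} (mk {t} {o′} t≡ o≡)
        with trans (sym (ℕ.+-identityʳ t)) t≡ | trans (sym (++-identityʳ o′)) o≡
      ... | refl | refl = exit (+≰ᵇ+ {suc t} ℕ.≤-refl) mk
      emitting-body {k = suc k} (mk {t} {o′} t≡ o≡) =
        step (+≤ᵇ+ (subst (t <_) t≡ (ℕ.m<m+n t (s≤s z≤n))))
          (exec-⨾ (exec-print′ (cong (λ q → cells l (+ q)) (address₁ a t))
          (exec-⨾ (exec-print′ (cong (λ q → cells l (+ q)) (address₂ a δ t))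
          (exec-⨾ (exec-print′ (cong (λ q → cells l (+ q)) (address₁ c t))
          (exec-≔ (mk (trans (sym (ℕ.+-suc t k)) t≡) (trans regroup o≡)))))))))
        where
        regroup : ∀ {u v w : ℤ} {r} → (((o′ ∷ʳ u) ∷ʳ v) ∷ʳ w) ++ r ≡ o′ ++ u ∷ v ∷ w ∷ r
        regroup {u} {v} {w} {r} = trans (++-assoc ((o′ ∷ʳ u) ∷ʳ v) [ w ] r)
          (trans (++-assoc (o′ ∷ʳ u) [ v ] (w ∷ r)) (++-assoc o′ [ u ] (v ∷ w ∷ r)))

    Covers : ℕ → List ParamInstance → Set
    Covers δ ds = ∀ {δ′ a c} → δ′ < δ → a + δ′ < G → c < G →
      Solution a (a + δ′) c → Covered ds

    -- Every visit outputs one triple and lowers `α + c` by one, so this number bounds both the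
    -- remaining rounds and the remaining outputs. A solution at distance `δ` is covered already or
    -- still lies ahead of both pointers.
    data Walking (δ K κ : ℕ) : Config → Set where
      mk : ∀ {a α c h} ds → a + α + δ ≡ G → c < G → κ ≡ α + c →
        All Sound ds → length ds + κ ≤ K → Covers δ ds →
        (∀ {a′ c′} → a′ + δ < G → c′ < G → Solution a′ (a′ + δ) c′ →
          Covered ds ⊎ a ≤ a′ × c′ ≤ c) →
        Walking δ K κ (conf δ a c h (serialiseAll ds))

    data Walked (δ K : ℕ) : Config → Set where
      mk : ∀ {i j h} ds → All Sound ds → length ds ≤ K → Covers (suc δ) ds →
        Walked δ K ⟪ file n e N d m B s (δ * B) f i j h g , l , serialiseAll ds ⟫

    visitCost : ℕ
    visitCost = 14 + (B * 26 + 5 + 27)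

    module _ (mono : Monotone) (δ K : ℕ) where

      -- The current triple is already in `ds`. Before the visit the measure was `suc α + c`; it
      -- becomes `α + c` whichever pointer moves.
      exec-advance : ∀ {a α c h} ds → a + suc α + δ ≡ G → c < G →
        All Sound ds → length ds + (α + c) ≤ K → Covers δ ds →
        (Solution a (a + δ) c → Covered ds) →
        (∀ {a′ c′} → a′ + δ < G → c′ < G → Solution a′ (a′ + δ) c′ →
          Covered ds ⊎ a ≤ a′ × c′ ≤ c) →
        Exec advance (conf δ a c h (serialiseAll ds)) 27 (Walking δ K (α + c))
      exec-advance {a} {α} {c} {h} ds a≡ c< sound len cov here-cov cur = go
        where
        a+δ< : a + δ < G
        a+δ< = +-suc-+-< {a} {α} {δ} a≡
        a< : a < G
        a< = ℕ.≤-<-trans (ℕ.m≤m+n a δ) a+δ<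

        σ≡ : cells l (+ (s + a * B + B) ℤ.- + 1) ℤ.+ cells l (+ (s + a * B + δ * B + B) ℤ.- + 1)
               ℤ.+ cells l (+ (s + c * B)) ≡ extremes a (a + δ) c
        σ≡ = cong₂ ℤ._+_ (cong₂ ℤ._+_
          (cong (cells l) (trans (+-suc-⊖1 _ β) (cong +_ (address₁ a β))))
          (cong (cells l) (trans (+-suc-⊖1 _ β) (cong +_ (address₂ a δ β)))))
          (cong (λ q → cells l (+ q)) (trans (sym (ℕ.+-identityʳ _)) (address₁ c 0)))

        next-a : (∀ {c′} → c′ < G → c′ ≤ c → Solution a (a + δ) c′ → Covered ds) →
          Exec (9 ≔ var 5 ⊕ var 9) (conf δ a c h (serialiseAll ds)) 4 (Walking δ K (α + c))
        next-a f′ = exec-≔′ {v = + (s + suc a * B)} (cong +_ swap)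
          (mk ds (trans (cong (_+ δ) (sym (ℕ.+-suc a α))) a≡) c< refl sound len cov cur′)
          where
          swap : B + (s + a * B) ≡ s + (B + a * B)
          swap = trans (sym (ℕ.+-assoc B s _))
            (trans (cong (_+ a * B) (ℕ.+-comm B s)) (ℕ.+-assoc s B _))
          cur′ : ∀ {a′ c′} → a′ + δ < G → c′ < G → Solution a′ (a′ + δ) c′ →
            Covered ds ⊎ suc a ≤ a′ × c′ ≤ c
          cur′ a′< c′< sol with cur a′< c′< sol
          ... | inj₁ done = inj₁ done
          ... | inj₂ (a≤a′ , c′≤c) with ℕ.m≤n⇒m<n∨m≡n a≤a′
          ...   | inj₁ a<a′ = inj₂ (a<a′ , c′≤c)
          ...   | inj₂ refl = inj₁ (f′ c′< c′≤c sol)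

        next-c : ∀ {c₀} → c ≡ suc c₀ → ¬ extremes a (a + δ) c ℤ.≤ 0ℤ →
          Exec (10 ≔ var 10 ⊖ var 5) (conf δ a c h (serialiseAll ds)) 4 (Walking δ K (α + c))
        next-c {c₀} refl σ≰0 =
          exec-≔′ {v = + (s + c₀ * B)} (trans (cong (λ q → + q ℤ.- + B) swap) (+-cancel-⊖ B _))
          (mk {α = suc α} ds a≡ (ℕ.≤-trans (ℕ.n≤1+n _) c<) (ℕ.+-suc α c₀) sound len cov cur′)
          where
          swap : s + (B + c₀ * B) ≡ B + (s + c₀ * B)
          swap = trans (sym (ℕ.+-assoc s B _))
            (trans (cong (_+ c₀ * B) (ℕ.+-comm s B)) (ℕ.+-assoc B s _))
          cur′ : ∀ {a′ c′} → a′ + δ < G → c′ < G → Solution a′ (a′ + δ) c′ →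
            Covered ds ⊎ a ≤ a′ × c′ ≤ c₀
          cur′ a′< c′< sol with cur a′< c′< sol
          ... | inj₁ done = inj₁ done
          ... | inj₂ (a≤a′ , c′≤c) with ℕ.m≤n⇒m<n∨m≡n c′≤c
          ...   | inj₁ c′<c = inj₂ (a≤a′ , ℕ.≤-pred c′<c)
          -- A solution that uses `c` itself lies in the triple just output if its first block is
          -- `a`, and is excluded by `drop-last` if that block comes later.
          ...   | inj₂ refl with ℕ.m≤n⇒m<n∨m≡n a≤a′
          ...     | inj₂ refl = inj₁ (here-cov sol)
          ...     | inj₁ a<a′ = contradiction sol
            (drop-last mono σ≰0 a<a′ (ℕ.+-monoˡ-< δ a<a′)
              (ℕ.≤-<-trans (ℕ.m≤m+n _ δ) a′<) a′< c<)

        positive : ∀ c′ → c ≡ c′ → ¬ extremes a (a + δ) c ℤ.≤ 0ℤ →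
          Exec (ifte (var 10 ≼ var 6) (9 ≔ var 5 ⊕ var 9) (10 ≔ var 10 ⊖ var 5))
            (conf δ a c h (serialiseAll ds)) 7 (Walking δ K (α + c))
        positive zero refl σ≰0 = exec-true (+≤ᵇ+ (ℕ.≤-reflexive (ℕ.+-identityʳ s)))
          (next-a λ { _ z≤n → here-cov })
        positive (suc c₀) refl σ≰0 = exec-false (+≰ᵇ+ (ℕ.m<m+n s (s≤s z≤n))) (next-c refl σ≰0)

        go : Exec advance (conf δ a c h (serialiseAll ds)) 27 (Walking δ K (α + c))
        go with extremes a (a + δ) c ℤ.≤? 0ℤ
        ... | yes σ≤0 = consequence
          (exec-true (≤ᵇ-true (subst (ℤ._≤ 0ℤ) (sym σ≡) σ≤0))
            (next-a λ c′< c′≤c sol → here-cov (drop-first mono σ≤0 c′≤c a< a+δ< c< sol)))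
          id (ℕ.m≤m+n 24 3)
        ... | no  σ≰0 =
          exec-false (≤ᵇ-false (σ≰0 ∘ subst (ℤ._≤ 0ℤ) σ≡)) (positive c refl σ≰0)

      walking-body : ∀ {κ C} → Walking δ K κ C →
        Iteration (lit (+ 1) ⊕ (var 9 ⊕ var 7) ≼ var 1) visit visitCost (Walking δ K)
          (Walked δ K) κ C
      walking-body (mk {a} {zero} {c} {h} ds a≡ c< refl sound len cov cur) =
        exit (+≰ᵇ+ (s≤s (ℕ.≤-reflexive (sym end))))
          (mk ds sound (ℕ.≤-trans (ℕ.m≤m+n _ c) len) cov′)
        where
        a+δ≡ : a + δ ≡ G
        a+δ≡ = trans (cong (_+ δ) (sym (ℕ.+-identityʳ a))) a≡
        end : s + a * B + δ * B ≡ s + G * B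
        end = trans (ℕ.+-assoc s (a * B) (δ * B))
          (cong (s ℕ.+_) (trans (sym (ℕ.*-distribʳ-+ B a δ)) (cong (_* B) a+δ≡)))
        cov′ : Covers (suc δ) ds
        cov′ {δ′} δ′< a′< c′< sol with ℕ.m≤n⇒m<n∨m≡n (ℕ.≤-pred δ′<)
        ... | inj₁ δ′<δ = cov δ′<δ a′< c′< sol
        ... | inj₂ refl with cur a′< c′< sol
        ...   | inj₁ done = done
        ...   | inj₂ (a≤a′ , _) = contradiction
          (ℕ.≤-trans (ℕ.≤-reflexive (sym a+δ≡)) (ℕ.+-monoˡ-≤ δ a≤a′)) (ℕ.<⇒≱ a′<)
      walking-body (mk {a} {suc α} {c} {h} ds a≡ c< refl sound len cov cur) =
        step (+≤ᵇ+ inside)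
          (exec-⨾ (exec-print′ header (exec-⨾ (exec-print′ header (exec-⨾ (exec-≔ (exec-⨾
            (consequence (exec-while (Emitting δ a c _) (emitting-body δ a c) {k = B}
              (mk {t = 0} refl refl))
              (λ { (mk {h = h′}) →
                subst (λ o → Exec advance (conf δ a c h′ o) 27 (Walking δ K (α + c)))
                (sym output≡)
                (exec-advance (ds ∷ʳ J) a≡ c<
                  (All.++⁺ sound (triple-sound a< a+δ< c< ∷ []))
                  (ℕ.≤-trans (ℕ.≤-reflexive len′) len)
                  (λ p q r sol → Any.++⁺ˡ (cov p q r sol))
                  (λ sol → Any.++⁺ʳ ds (here (triple-yes sol)))
                  λ p q sol → map₁ Any.++⁺ˡ (cur p q sol)) })
              ℕ.≤-refl))))))))
        where
        E : List ℤ
        E = triple a (a + δ) c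
        J : ParamInstance
        J = instanceOf E
        a+δ< : a + δ < G
        a+δ< = +-suc-+-< {a} {α} {δ} a≡
        a< : a < G
        a< = ℕ.≤-<-trans (ℕ.m≤m+n a δ) a+δ<
        inside : suc (s + a * B + δ * B) ≤ s + G * B
        inside = ℕ.≤-trans (ℕ.≤-reflexive (cong suc (trans (ℕ.+-assoc s (a * B) (δ * B))
            (cong (s ℕ.+_) (sym (ℕ.*-distribʳ-+ B a δ))))))
          (ℕ.+-monoʳ-< s (ℕ.*-monoˡ-< B a+δ<))
        header : + (B + B + B) ≡ + length E
        header = cong +_ (trans
          (trans (ℕ.+-assoc B B B)
          (trans (cong (λ q → B + (B + q)) (sym (ℕ.+-identityʳ B))) (ℕ.*-comm 3 B)))
          (sym (length-entries a (a + δ) c 0 B)))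
        len′ : length (ds ∷ʳ J) + (α + c) ≡ length ds + suc (α + c)
        len′ = trans (cong (_+ (α + c)) (length-++ ds)) (ℕ.+-assoc (length ds) 1 (α + c))
        output≡ : ((serialiseAll ds ∷ʳ + length E) ∷ʳ + length E) ++ E ≡ serialiseAll (ds ∷ʳ J)
        output≡ = begin
          ((serialiseAll ds ∷ʳ + length E) ∷ʳ + length E) ++ E
            ≡⟨ ++-assoc (serialiseAll ds ∷ʳ + length E) _ E ⟩
          (serialiseAll ds ∷ʳ + length E) ++ + length E ∷ E
            ≡⟨ ++-assoc (serialiseAll ds) _ _ ⟩
          serialiseAll ds ++ + length E ∷ + length E ∷ E
            ≡⟨ cong (serialiseAll ds ++_) (serialise-instanceOf E) ⟨
          serialiseAll ds ++ serialise J
            ≡⟨ cong (serialiseAll ds ++_) (++-identityʳ (serialise J)) ⟨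
          serialiseAll ds ++ serialiseAll [ J ]
            ≡⟨ concatMap-++ serialise ds [ J ] ⟨
          serialiseAll (ds ∷ʳ J)                               ∎
          where open ≡-Reasoning

  module _ (l : List ℤ) (s β γ : ℕ) (n d m f g : ℕ) where
    open Blocks l s β γ
    open Triples l s β γ n (G * B) d m f g using
      (e; Covers; Walking; Walked; walking-body; visitCost)
    private
      module T = Triples l s β γ n (G * B) d m f g

    data Enumerating (κ : ℕ) : Config → Set where
      mk : ∀ {δ i j h} ds → δ + κ ≡ G → All Sound ds → length ds ≤ δ * (G + G) → Covers δ ds →
        Enumerating κ ⟪ file n e (G * B) d m B s (δ * B) f i j h g , l , serialiseAll ds ⟫

    data Enumerated : Config → Set where
      mk : ∀ {C} ds → out C ≡ serialiseAll ds → All Sound ds → length ds ≤ G * (G + G) →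
        Covers G ds →
        Enumerated C

    walkCost : ℕ
    walkCost = (G + G) * (7 + visitCost) + 17

    enumerating-body : Monotone → ∀ {κ C} → Enumerating κ C →
      Iteration (lit (+ 1) ⊕ var 7 ≼ var 2)
        (walk ⨾ 7 ≔ var 5 ⊕ var 7) walkCost Enumerating Enumerated κ C
    enumerating-body mono {zero} (mk {δ} ds δ≡ sound len cov)
      with trans (sym (ℕ.+-identityʳ δ)) δ≡
    ... | refl = exit (+≰ᵇ+ {suc (G * B)} ℕ.≤-refl) (mk ds refl sound len cov)
    enumerating-body mono {suc κ} (mk {δ} {h = h} ds δ≡ sound len cov) =
      step (+≤ᵇ+ (ℕ.*-monoˡ-< B δ<G))
        (consequence
          (exec-⨾ (consequence
            (exec-⨾ (exec-≔′ (cong +_ (sym (ℕ.+-identityʳ s))) (exec-⨾ (exec-≔′ last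
              (exec-while (Walking δ (suc δ * (G + G)))
                -- There are `suc κ` moves of `a` until `b` runs off the end, and `γ` moves of `c`
                -- from the last block down to the first.
                (walking-body mono δ (suc δ * (G + G))) {k = suc κ + γ}
                (T.mk {a = 0} {α = suc κ} ds
                  (trans (ℕ.+-comm (suc κ) δ) δ≡) ℕ.≤-refl refl sound len′ cov
                  λ _ c′< _ → inj₂ (z≤n , ℕ.≤-pred c′<)))))))
            (λ { (T.mk ds′ sound′ len″ cov′) → exec-≔
              (mk {δ = suc δ} ds′ (trans (sym (ℕ.+-suc δ κ)) δ≡) sound′ len″ cov′) })
            ℕ.≤-refl))
          id cost≤)
      where
      δ<G : δ < G
      δ<G = subst (δ <_) δ≡ (ℕ.m<m+n δ (s≤s z≤n))
      κ<G : suc κ ≤ G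
      κ<G = ℕ.≤-trans (ℕ.m≤n+m (suc κ) δ) (ℕ.≤-reflexive δ≡)
      last : + (s + suc γ * B) ℤ.- + B ≡ + (s + γ * B)
      last = trans (cong (λ q → + q ℤ.- + B) (trans (sym (ℕ.+-assoc s B _))
        (trans (cong (_+ γ * B) (ℕ.+-comm s B)) (ℕ.+-assoc B s _)))) (+-cancel-⊖ B _)
      steps≤ : suc κ + γ ≤ G + G
      steps≤ = ℕ.+-mono-≤ κ<G (ℕ.n≤1+n γ)
      len′ : length ds + (suc κ + γ) ≤ suc δ * (G + G)
      len′ = ℕ.≤-trans (ℕ.+-mono-≤ len steps≤) (ℕ.≤-reflexive (ℕ.+-comm (δ * (G + G)) _))
      cost≤ : 2 + (4 + ((suc κ + γ) * (7 + visitCost) + 7)) + 4 ≤ walkCost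
      cost≤ = ℕ.≤-trans (ℕ.≤-reflexive
        (solve 1 (λ y → con 2 :+ (con 4 :+ (y :+ con 7)) :+ con 4 := y :+ con 17) refl
        ((suc κ + γ) * (7 + visitCost))))
        (ℕ.+-monoˡ-≤ 17 (ℕ.*-monoˡ-≤ (7 + visitCost) steps≤))
        where
        open +-*-Solver

    exec-enumerate : Monotone → ∀ {w i j h} →
      Exec enumerate ⟪ file n e (G * B) d m B s w f i j h g , l , [] ⟫
        (2 + (G * (5 + walkCost) + 5)) Enumerated
    exec-enumerate mono = exec-⨾ (exec-≔ (exec-while Enumerating (enumerating-body mono) {k = G}
      (mk {δ = 0} [] refl [] z≤n λ ())))

-- The whole program

cells-∈ : ∀ {l i} → i < length l → cells l (+ i) ∈ l
cells-∈ {_ ∷ _} {zero}  _         = here refl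
cells-∈ {_ ∷ _} {suc i} (s≤s i<) = there (cells-∈ i<)

∈-cells : ∀ {l v} → v ∈ l → ∃[ i ] i < length l × v ≡ cells l (+ i)
∈-cells (here refl) = 0 , s≤s z≤n , refl
∈-cells (there v∈) with ∈-cells v∈
... | i , i< , eq = suc i , s≤s i< , eq

Sorted⇒cells-mono : ∀ {l i j} → Sorted l → i ≤ j → j < length l →
  cells l (+ i) ℤ.≤ cells l (+ j)
Sorted⇒cells-mono l↗ = go (Linked⇒AllPairs ℤ.≤-trans l↗)
  where
  go : ∀ {l i j} → AllPairs ℤ._≤_ l → i ≤ j → j < length l → cells l (+ i) ℤ.≤ cells l (+ j)
  go {_ ∷ _} {zero}  {zero}  _        _         _         = ℤ.≤-refl
  go {_ ∷ _} {zero}  {suc j} (v≤ ∷ _) _         (s≤s j<) = All.lookup v≤ (cells-∈ j<)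
  go {_ ∷ _} {suc i} {suc j} (_ ∷ ps) (s≤s i≤j) (s≤s j<) = go ps i≤j j<

main : Program
-- The empty input has no solution, and printing no instance says so. Padding it would read a 0 from
-- the empty tape and create the solution 0 + 0 + 0.
main = ifte (var 0 ≼ lit (+ 0)) skip
  (2 ≔ lit (+ 1) ⨾ double ⨾ 5 ≔ lit (+ 1) ⨾ split ⨾ pad ⨾ sort ⨾ enumerate)

enumerateCost : (B G : ℕ) → ℕ
enumerateCost B G =
  2 + (G * (5 + ((G + G) * (7 + (14 + (B * 26 + 5 + 27))) + 17)) + 5)

mainCost : (ℓ k B G : ℕ) → ℕ
mainCost ℓ k B G =
  3 + (2 + ((suc ℓ * 11 + 3) + (2 + ((suc ℓ * 20 + 8) + ((k * 13 + 5) +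
    ((suc ℓ * (2 ^ suc ℓ * 56 + 16) + 7) + enumerateCost B G))))))

-- Correctness of the whole program

module Main (x : Real) where
  open Logic x
  open Setup x
  open Sort x
  open Enumeration x

  Descent-+ : ∀ {m j m′ j′} → Descent m j m′ j′ → m′ + j′ ≡ m + j
  Descent-+ (stop _)                  = refl
  Descent-+ (next {m} {j} _ d) = trans (Descent-+ d) (sym (ℕ.+-suc m j))

  data Final (A : List ℤ) (B G : ℕ) (c : Config) : Set where
    mk : ∀ ds → out c ≡ serialiseAll ds → length ds ≤ G * (G + G) →
      All (λ J → proj₁ J ≡ B * 3) ds →
      (Solvable A ⇔ Any (λ J → Yes (proj₂ J)) ds) → Final A B G c

  module _ {l : List ℤ} {s β γ n N d m f g : ℕ} where
    open Blocks l s β γ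

    V≡F : ∀ i → V (i ℕ./ B) (i ℕ.% B) ≡ F i
    V≡F i = cong F (trans (ℕ.+-comm (i ℕ./ B * B) (i ℕ.% B)) (sym (ℕ.m≡m%n+[m/n]*n i B)))

    Covers⇒Covered≤ : ∀ {ds} → Triples.Covers l s β γ n N d m f g G ds →
      ∀ {p q r} → p ℕ./ B ≤ q ℕ./ B → p < G * B → q < G * B → r < G * B →
      F p ℤ.+ F q ℤ.+ F r ≡ 0ℤ → Covered ds
    Covers⇒Covered≤ cov {p} {q} {r} p≤q p< q< r< eq =
      cov {q ℕ./ B ∸ p ℕ./ B} {p ℕ./ B} {r ℕ./ B}
      (ℕ.≤-<-trans (ℕ.m∸n≤m (q ℕ./ B) (p ℕ./ B)) (ℕ.m<n*o⇒m/o<n q<))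
      (subst (_< G) (sym (ℕ.m+[n∸m]≡n p≤q)) (ℕ.m<n*o⇒m/o<n q<)) (ℕ.m<n*o⇒m/o<n r<)
      (subst (λ b → Solution (p ℕ./ B) b (r ℕ./ B)) (sym (ℕ.m+[n∸m]≡n p≤q))
        (p ℕ.% B , q ℕ.% B , r ℕ.% B , ℕ.m%n<n p B , ℕ.m%n<n q B , ℕ.m%n<n r B ,
         trans (cong₂ ℤ._+_ (cong₂ ℤ._+_ (V≡F p) (V≡F q)) (V≡F r)) eq))

    -- The walks only visit `a ≤ b`. The sum is symmetric in its first two summands, so they are
    -- swapped if their blocks come in the other order.
    Covers⇒Covered : ∀ {ds} → Triples.Covers l s β γ n N d m f g G ds →
      ∀ {p q r} → p < G * B → q < G * B → r < G * B → F p ℤ.+ F q ℤ.+ F r ≡ 0ℤ → Covered ds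
    Covers⇒Covered {ds} cov {p} {q} {r} p< q< r< eq with ℕ.≤-total (p ℕ./ B) (q ℕ./ B)
    ... | inj₁ p≤q = Covers⇒Covered≤ cov p≤q p< q< r< eq
    ... | inj₂ q≤p = Covers⇒Covered≤ cov q≤p q< p< r<
      (trans (cong (ℤ._+ F r) (ℤ.+-comm (F q) (F p))) eq)

  exec-enumerate-sorted : ∀ {n N d m B β γ A S C} → N ≡ suc γ * B → B ≡ suc β → length S ≡ N →
    (∀ {v} → v ∈ S → v ∈ A) → (∀ {v} → v ∈ A → v ∈ S) →
    SortedSegment n N d m B S C →
    Exec enumerate C (enumerateCost B (suc γ)) (Final A B (suc γ))
  exec-enumerate-sorted {n} {d = d} {m} {β = β} {γ} {A} {S} refl refl |S| S⊆A A⊆S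
    (mk {s = s} {f = f} {g = g} {l = l} R R↗ R↭S seg refl)
    = consequence (subst
        (λ r → Exec enumerate ⟪ file n (s + r) (G * B) d m B s _ f _ _ _ g , l , [] ⟫ _
          (Enumerated l s β γ n d m f g))
        (sym |R|) (exec-enumerate l s β γ n d m f g mono)) finish ℕ.≤-refl
    where
    open Blocks l s β γ
    |R| : length R ≡ G * B
    |R| = trans (↭-length R↭S) |S|
    F≡ : ∀ {i} → i < G * B → F i ≡ cells R (+ i)
    F≡ {i} i< = Segment-cells s R seg (subst (i <_) (sym |R|) i<)
    mono : Monotone
    mono {i} {j} i≤j j< = subst₂ ℤ._≤_ (sym (F≡ (ℕ.≤-<-trans i≤j j<))) (sym (F≡ j<))
      (Sorted⇒cells-mono R↗ i≤j (subst (j <_) (sym |R|) j<))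
    Occurs⇒∈ : ∀ {v} → Occurs v → v ∈ A
    Occurs⇒∈ (i , i< , eq) = S⊆A (∈-resp-↭ R↭S
      (subst (_∈ R) (sym (trans eq (F≡ i<))) (cells-∈ (subst (i <_) (sym |R|) i<))))
    ∈⇒Occurs : ∀ {v} → v ∈ A → Occurs v
    ∈⇒Occurs v∈ with ∈-cells (∈-resp-↭ (↭-sym R↭S) (A⊆S v∈))
    ... | i , i< , eq = i , subst (i <_) |R| i< , trans eq (sym (F≡ (subst (i <_) |R| i<)))
    finish : ∀ {C} → Enumerated l s β γ n d m f g C → Final A B G C
    finish (mk ds out≡ sound len cov) = mk ds out≡ len (All.map proj₁ sound) (mk⇔ to from)
      where
      to : Solvable A → Any (λ J → Yes (proj₂ J)) ds
      to (_ , _ , _ , x∈ , y∈ , z∈ , eq) with ∈⇒Occurs x∈ | ∈⇒Occurs y∈ | ∈⇒Occurs z∈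
      ... | _ , p< , refl | _ , q< , refl | _ , r< , refl = 
        Covers⇒Covered {l} {s} {β} {γ} {n} {G * B} {d} {m} {f} {g} cov p< q< r< eq
      from : Any (λ J → Yes (proj₂ J)) ds → Solvable A
      from covered with find covered
      ... | (_ , J) , J∈ , yesJ with All.lookup sound J∈ | Yes⇒Solvable J yesJ
      ...   | _ , occurs | _ , _ , _ , x∈ , y∈ , z∈ , eq = _ , _ , _ ,
        Occurs⇒∈ (All.lookup occurs x∈) , Occurs⇒∈ (All.lookup occurs y∈) ,
        Occurs⇒∈ (All.lookup occurs z∈) , eq

  exec-main : ∀ {n a xs ℓ m j} → n ≡ length (a ∷ xs) → 2 ^ ℓ ≤ n → n < 2 ^ suc ℓ →
    Descent 0 (suc ℓ) m j →
    Exec main ⟪ file n n 0 0 0 0 0 0 0 0 0 0 0 , a ∷ xs , [] ⟫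
      (mainCost ℓ (2 ^ suc ℓ ∸ n) (2 ^ m) (2 ^ j))
      (Final (a ∷ xs) (2 ^ m) (2 ^ j))
  exec-main {n} {a} {xs} {ℓ} {m} {j} n≡ lower upper desc with 2 ^ j in G≡ | ℕ.m^n>0 2 j
  ... | suc γ | _ =
    exec-false (+≰ᵇ+ (ℕ.<-≤-trans (ℕ.m^n>0 2 ℓ) lower)) (exec-⨾ (exec-≔ (exec-⨾
      (consequence (exec-double {ℓ = ℓ} lower upper) (λ { refl → exec-⨾ (exec-≔ (exec-⨾
      (consequence (exec-split {L = suc ℓ} desc) (λ { refl → exec-⨾
      (consequence (exec-pad {k = 2 ^ suc ℓ ∸ n} n≡ (ℕ.m+[n∸m]≡n (ℕ.<⇒≤ upper)))
        (λ { (mk {r = r} len as) → exec-⨾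
      (consequence (exec-sort {L = suc ℓ} len refl)
        (exec-enumerate-sorted N≡ (sym (ℕ.suc-pred (2 ^ m) {{ℕ.m^n≢0 2 m}})) len (back as)
        (λ v∈ → List.∈-++⁺ˡ v∈))
      ℕ.≤-refl) }) ℕ.≤-refl) }) ℕ.≤-refl))) }) ℕ.≤-refl))))
    where
    N≡ : 2 ^ suc ℓ ≡ suc γ * 2 ^ m
    N≡ = trans (cong (2 ^_) (sym (Descent-+ desc))) (trans (ℕ.^-distribˡ-+-* 2 m j)
      (trans (cong (2 ^ m ℕ.*_) G≡) (ℕ.*-comm (2 ^ m) (suc γ))))
    back : ∀ {r v} → All (_≡ a) r → v ∈ (a ∷ xs) ++ r → v ∈ a ∷ xs
    back {r} as v∈ with List.∈-++⁻ (a ∷ xs) v∈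
    ... | inj₁ v∈xs = v∈xs
    ... | inj₂ v∈r  = here (All.lookup as v∈r)

-- Real numbers by their approximations

i≤∣i∣ : ∀ i → i ℤ.≤ + ∣ i ∣
i≤∣i∣ (+ _)    = ℤ.≤-refl
i≤∣i∣ -[1+ _ ] = -≤+

module _ where
  open ℤ.+-*-Solver

  +-cancelʳ-≤ : ∀ k {i j} → i ℤ.+ k ℤ.≤ j ℤ.+ k → i ℤ.≤ j
  +-cancelʳ-≤ k {i} {j} le = subst₂ ℤ._≤_ (cancel i) (cancel j) (ℤ.+-monoˡ-≤ (ℤ.- k) le)
    where
    cancel : ∀ i → i ℤ.+ k ℤ.+ ℤ.- k ≡ i
    cancel i = solve 2 (λ i k → i :+ k :+ :- k := i) refl i k

  -- Clearing denominators

  toℚᵘ-/1 : ∀ a → toℚᵘ (a ℚ./ 1) ℚᵘ.≃ mkℚᵘ a 0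
  toℚᵘ-/1 a = ℚ.toℚᵘ-fromℚᵘ (mkℚᵘ a 0)

  toℚᵘ-*/1 : ∀ p k → toℚᵘ (p ℚ.* (+ k ℚ./ 1)) ℚᵘ.≃ toℚᵘ p ℚᵘ.* mkℚᵘ (+ k) 0
  toℚᵘ-*/1 p k = ℚᵘ.≃-trans (ℚ.toℚᵘ-homo-* p (+ k ℚ./ 1)) (ℚᵘ.*-congˡ {toℚᵘ p} (toℚᵘ-/1 (+ k)))

  ℚ<ℝ-ℤ : ∀ {x} μ → μ ℚ<ℝ x → ∃[ k ] ↥ μ ℤ.* + k ℤ.+ ↧ μ ℤ.< approx x k ℤ.* ↧ μ
  ℚ<ℝ-ℤ {x} μ@(mkℚ u d _) (k , lt) = k , subst₂ ℤ._<_
    (solve 3 (λ u k v →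
      (u :* k :* con (+ 1) :+ con (+ 1) :* (v :* con (+ 1))) :* con (+ 1) := u :* k :+ v) refl u
      (+ k) (+ suc d))
    (solve 2 (λ a v → a :* (v :* con (+ 1) :* con (+ 1)) := a :* v) refl (approx x k) (+ suc d))
    (ℚᵘ.drop-*<* (ℚᵘ.<-respʳ-≃ (toℚᵘ-/1 (approx x k)) (ℚᵘ.<-respˡ-≃
      (ℚᵘ.≃-trans (ℚ.toℚᵘ-homo-+ (μ ℚ.* (+ k ℚ./ 1)) 1ℚ) (ℚᵘ.+-congˡ 1ℚᵘ (toℚᵘ-*/1 μ k)))
      (ℚ.toℚᵘ-mono-< lt))))

  ℝ<ℚ-ℤ : ∀ {x} μ → x ℝ<ℚ μ → ∃[ k ] approx x k ℤ.* ↧ μ ℤ.+ ↧ μ ℤ.< ↥ μ ℤ.* + k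
  ℝ<ℚ-ℤ {x} μ@(mkℚ u d _) (k , lt) = k , subst₂ ℤ._<_
    (solve 2 (λ a v → (a :* con (+ 1) :+ con (+ 1) :* con (+ 1)) :*
      (v :* con (+ 1)) := a :* v :+ v) refl (approx x k) (+ suc d))
    (solve 2 (λ u k → u :* k :* (con (+ 1) :* con (+ 1)) := u :* k) refl u (+ k))
    (ℚᵘ.drop-*<* (ℚᵘ.<-respʳ-≃ (toℚᵘ-*/1 μ k) (ℚᵘ.<-respˡ-≃
      (ℚᵘ.≃-trans (ℚ.toℚᵘ-homo-+ (approx x k ℚ./ 1) 1ℚ) (ℚᵘ.+-congˡ 1ℚᵘ (toℚᵘ-/1 (approx x k))))
      (ℚ.toℚᵘ-mono-< lt))))

  private
    two : ℚ
    two = + 2 ℚ./ 1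

  countExponent-ℤ : ∀ μ r → two ℚ.* μ ℚ.≤ r ℚ.* (two ℚ.+ μ) →
    + 2 ℤ.* ↥ μ ℤ.* ↧ r ℤ.≤ ↥ r ℤ.* (+ 2 ℤ.* ↧ μ ℤ.+ ↥ μ)
  countExponent-ℤ μ@(mkℚ u d _) r@(mkℚ p e _) le = ℤ.*-cancelʳ-≤-pos _ _ (+ suc d) (subst₂ ℤ._≤_
    (solve 3 (λ u v q → con (+ 2) :* u :* (q :* (con (+ 1) :* v)) := con (+ 2) :* u :* q :* v)
      refl u (+ suc d) (+ suc e))
    (solve 3 (λ u v p →
      p :* (con (+ 2) :* v :+ u :* con (+ 1)) :* (con (+ 1) :* v) := p :*
      (con (+ 2) :* v :+ u) :* v) refl u (+ suc d) p)
    (ℚᵘ.drop-*≤* (ℚᵘ.≤-respʳ-≃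
      (ℚᵘ.≃-trans (ℚ.toℚᵘ-homo-* r (two ℚ.+ μ)) (ℚᵘ.*-congˡ {toℚᵘ r} (ℚ.toℚᵘ-homo-+ two μ)))
      (ℚᵘ.≤-respˡ-≃ (ℚ.toℚᵘ-homo-* two μ) (ℚ.toℚᵘ-mono-≤ le)))))

  sizeExponent-ℤ : ∀ μ r → two ℚ.≤ r ℚ.* (two ℚ.+ μ) →
    + 2 ℤ.* ↧ r ℤ.* ↧ μ ℤ.≤ ↥ r ℤ.* (+ 2 ℤ.* ↧ μ ℤ.+ ↥ μ)
  sizeExponent-ℤ μ@(mkℚ u d _) r@(mkℚ p e _) le = subst₂ ℤ._≤_
    (solve 2 (λ v q → con (+ 2) :* (q :* (con (+ 1) :* v)) := con (+ 2) :* q :* v) refl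
      (+ suc d) (+ suc e))
    (solve 3 (λ u v p →
      p :* (con (+ 2) :* v :+ u :* con (+ 1)) :* con (+ 1) := p :* (con (+ 2) :* v :+ u)) refl u
      (+ suc d) p)
    (ℚᵘ.drop-*≤* (ℚᵘ.≤-respʳ-≃
      (ℚᵘ.≃-trans (ℚ.toℚᵘ-homo-* r (two ℚ.+ μ)) (ℚᵘ.*-congˡ {toℚᵘ r} (ℚ.toℚᵘ-homo-+ two μ)))
      (ℚ.toℚᵘ-mono-≤ le)))

  -- Approximations against rational bounds

  module _ (x : Real) where
    private
      a = approx x

    approx-≤ : ∀ k l → a k ℤ.* + l ℤ.≤ a l ℤ.* + k ℤ.+ + (k + l)
    approx-≤ k l = subst₂ ℤ._≤_
      (solve 2 (λ s t → s :- t :+ t := s) refl (a k ℤ.* + l) (a l ℤ.* + k))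
      (ℤ.+-comm (+ (k + l)) (a l ℤ.* + k))
      (ℤ.+-monoˡ-≤ (a l ℤ.* + k)
        (ℤ.≤-trans (i≤∣i∣ (a k ℤ.* + l ℤ.- a l ℤ.* + k)) (+≤+ (regular x k l))))

    -- Regularity at 1 and 0. Together with `approx₀≤1` it rules out 0 as the witness of a strict
    -- comparison with a rational.
    -1≤approx₀ : 0ℤ ℤ.≤ a 0 ℤ.+ + 1
    -1≤approx₀ = subst₂ ℤ._≤_ (ℤ.*-zeroʳ (a 1)) (cong (ℤ._+ + 1) (ℤ.*-identityʳ (a 0)))
      (approx-≤ 1 0)

    approx₀≤1 : a 0 ℤ.≤ + 1
    approx₀≤1 = subst₂ ℤ._≤_ (ℤ.*-identityʳ (a 0)) (cong (ℤ._+ + 1) (ℤ.*-zeroʳ (a 1)))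
      (approx-≤ 0 1)

    -- Regularity compares `a m` with `a k` at an error of `m + k`. The summand 1 in the definition
    -- of `ℝ<ℚ` pays for the part `m`; after division by `k` the part `k` leaves an error of 1, for
    -- every `m`.
    approx-upper : ∀ u v k → a k ℤ.* + suc v ℤ.+ + suc v ℤ.< u ℤ.* + k →
      ∀ m → a m ℤ.* + suc v ℤ.≤ u ℤ.* + m ℤ.+ + suc v
    approx-upper u v zero lt m = contradiction (ℤ.<-≤-trans
      (subst₂ ℤ._<_ (solve 2 (λ a v → a :* v :+ v := (a :+ con (+ 1)) :* v) refl (a 0)
        (+ suc v)) (ℤ.*-zeroʳ u) lt)
      (ℤ.*-monoʳ-≤-nonNeg (+ suc v) -1≤approx₀)) (ℤ.<-irrefl refl)
    approx-upper u v (suc k) lt m = ℤ.*-cancelˡ-≤-pos _ _ (+ suc k) (begin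
      + suc k ℤ.* (a m ℤ.* V)
        ≡⟨ solve 3 (λ a v k → k :* (a :* v) := a :* k :* v) refl (a m) V (+ suc k) ⟩
      a m ℤ.* + suc k ℤ.* V
        ≤⟨ ℤ.*-monoʳ-≤-nonNeg V (approx-≤ m (suc k)) ⟩
      (a (suc k) ℤ.* + m ℤ.+ (+ m ℤ.+ + suc k)) ℤ.* V
        ≡⟨ solve 4 (λ a v k m → (a :* m :+ (m :+ k)) :* v := (a :* v :+ v) :* m :+ k :* v) refl
          (a (suc k)) V (+ suc k) (+ m) ⟩
      (a (suc k) ℤ.* V ℤ.+ V) ℤ.* + m ℤ.+ + suc k ℤ.* V
        ≤⟨ ℤ.+-monoˡ-≤ (+ suc k ℤ.* V) (ℤ.*-monoʳ-≤-nonNeg (+ m) (ℤ.<⇒≤ lt)) ⟩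
      u ℤ.* + suc k ℤ.* + m ℤ.+ + suc k ℤ.* V
        ≡⟨ solve 4 (λ u v k m → u :* k :* m :+ k :* v := k :* (u :* m :+ v)) refl u V (+ suc k)
          (+ m) ⟩
      + suc k ℤ.* (u ℤ.* + m ℤ.+ V)                    ∎)
      where open ℤ.≤-Reasoning
            V = + suc v

    approx-lower : ∀ u v k → u ℤ.* + k ℤ.+ + suc v ℤ.< a k ℤ.* + suc v →
      ∀ m → u ℤ.* + m ℤ.≤ a m ℤ.* + suc v ℤ.+ + suc v
    approx-lower u v zero lt m =
      contradiction (ℤ.<-≤-trans lt (ℤ.*-monoʳ-≤-nonNeg (+ suc v) approx₀≤1))
      (ℤ.<-irrefl (trans (cong (ℤ._+ + suc v) (ℤ.*-zeroʳ u))
        (trans (ℤ.+-identityˡ _) (sym (ℤ.*-identityˡ (+ suc v))))))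
    approx-lower u v (suc k) lt m =
      ℤ.*-cancelˡ-≤-pos _ _ (+ suc k) (+-cancelʳ-≤ (V ℤ.* + m) (begin
      + suc k ℤ.* (u ℤ.* + m) ℤ.+ V ℤ.* + m
        ≡⟨ solve 4 (λ u v k m → k :* (u :* m) :+ v :* m := (u :* k :+ v) :* m) refl u V
          (+ suc k) (+ m) ⟩
      (u ℤ.* + suc k ℤ.+ V) ℤ.* + m                    ≤⟨ ℤ.*-monoʳ-≤-nonNeg (+ m) (ℤ.<⇒≤ lt) ⟩
      a (suc k) ℤ.* V ℤ.* + m
        ≡⟨ solve 3 (λ a v m → a :* v :* m := a :* m :* v) refl (a (suc k)) V (+ m) ⟩
      a (suc k) ℤ.* + m ℤ.* V
        ≤⟨ ℤ.*-monoʳ-≤-nonNeg V (approx-≤ (suc k) m) ⟩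
      (a m ℤ.* + suc k ℤ.+ (+ suc k ℤ.+ + m)) ℤ.* V
        ≡⟨ solve 4 (λ a v k m → (a :* k :+ (k :+ m)) :* v := k :* (a :* v :+ v) :+ v :* m) refl
          (a m) V (+ suc k) (+ m) ⟩
      + suc k ℤ.* (a m ℤ.* V ℤ.+ V) ℤ.+ V ℤ.* + m      ∎))
      where open ℤ.≤-Reasoning
            V = + suc v

-- Exponents

module _ where
  open +-*-Solver

  ^-distribʳ-* : ∀ k m n → (m * n) ^ k ≡ m ^ k * n ^ k
  ^-distribʳ-* zero    m n = refl
  ^-distribʳ-* (suc k) m n = trans (cong (m * n ℕ.*_) (^-distribʳ-* k m n))
    (solve 4 (λ m n a b → m :* n :* (a :* b) := m :* a :* (n :* b)) refl m n (m ^ k) (n ^ k))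

  -- With r = p / q the last hypothesis is E ≤ ℓ r + c. Thus additive slack `c` in the exponent of 2
  -- turns into the factor `2 ^ c` of the constant, independently of r.
  ^-bound : ∀ {y D C n} E ℓ c p q → y ≤ D * 2 ^ E → D * 2 ^ c ≤ C → 2 ^ ℓ ≤ n →
    E * q ≤ ℓ * p + c * q → y ^ q ≤ C ^ q * n ^ p
  ^-bound {y} {D} {C} {n} E ℓ c p q y≤ DC ℓ≤ E≤ = begin
    y ^ q                           ≤⟨ ℕ.^-monoˡ-≤ q y≤ ⟩
    (D * 2 ^ E) ^ q                 ≡⟨ ^-distribʳ-* q D (2 ^ E) ⟩
    D ^ q * (2 ^ E) ^ q             ≡⟨ cong (D ^ q ℕ.*_) (ℕ.^-*-assoc 2 E q) ⟩
    D ^ q * 2 ^ (E * q)             ≤⟨ ℕ.*-monoʳ-≤ (D ^ q) (ℕ.^-monoʳ-≤ 2 E≤) ⟩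
    D ^ q * 2 ^ (ℓ * p + c * q)     ≡⟨ cong (D ^ q ℕ.*_) (ℕ.^-distribˡ-+-* 2 (ℓ * p) (c * q)) ⟩
    D ^ q * (2 ^ (ℓ * p) * 2 ^ (c * q))
      ≡⟨ cong₂ (λ a b → D ^ q * (a * b)) (ℕ.^-*-assoc 2 ℓ p) (ℕ.^-*-assoc 2 c q) ⟨
    D ^ q * ((2 ^ ℓ) ^ p * (2 ^ c) ^ q)
      ≡⟨ solve 3 (λ a b c → a :* (b :* c) := (a :* c) :* b) refl (D ^ q) ((2 ^ ℓ) ^ p)
        ((2 ^ c) ^ q) ⟩
    D ^ q * (2 ^ c) ^ q * (2 ^ ℓ) ^ p ≡⟨ cong (_* (2 ^ ℓ) ^ p) (^-distribʳ-* q D (2 ^ c)) ⟨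
    (D * 2 ^ c) ^ q * (2 ^ ℓ) ^ p   ≤⟨ ℕ.*-mono-≤ (ℕ.^-monoˡ-≤ q DC) (ℕ.^-monoˡ-≤ p ℓ≤) ⟩
    C ^ q * n ^ p                   ∎
    where open ℕ.≤-Reasoning

  -- Put μ = u / v and r = p / q. From μ m ≤ 2 j + 1 follows (2 + μ) m ≤ 2 (m + j) + 1 = 2 ℓ + 3, so
  -- m ≤ r (ℓ + 3/2), which is at most ℓ r + 2 for r ≤ 1. For r ≥ 1 the trivial m ≤ ℓ + 1 suffices.
  size-exponent : ∀ {ℓ m j u v p q} .{{_ : ℕ.NonZero v}} → m + j ≡ suc ℓ →
    m ≡ 0 ⊎ u * m ≤ j * 2 * v + v → 2 * q * v ≤ p * (2 * v + u) → m * q ≤ ℓ * p + 2 * q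
  size-exponent _ (inj₁ refl) _ = z≤n
  size-exponent {ℓ} {m} {j} {u} {v} {p} {q} m+j (inj₂ um) pq with ℕ.≤-total p q
  ... | inj₂ q≤p = begin
    m * q             ≤⟨ ℕ.*-monoˡ-≤ q (ℕ.≤-trans (ℕ.m≤m+n m j) (ℕ.≤-reflexive m+j)) ⟩
    q + ℓ * q         ≤⟨ ℕ.+-mono-≤ (ℕ.m≤m+n q _) (ℕ.*-monoʳ-≤ ℓ q≤p) ⟩
    2 * q + ℓ * p     ≡⟨ ℕ.+-comm (2 * q) _ ⟩
    ℓ * p + 2 * q     ∎
    where open ℕ.≤-Reasoning
  ... | inj₁ p≤q = ℕ.*-cancelʳ-≤ (m * q) (ℓ * p + 2 * q) (2 * v) {{ℕ.m*n≢0 2 v}} (begin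
    m * q * (2 * v)
      ≡⟨ solve 3 (λ m q v → m :* q :* (con 2 :* v) := m :* (con 2 :* q :* v)) refl m q v ⟩
    m * (2 * q * v)                 ≤⟨ ℕ.*-monoʳ-≤ m pq ⟩
    m * (p * (2 * v + u))
      ≡⟨ solve 4 (λ m p v u → m :* (p :* (con 2 :* v :+ u)) := p :* (con 2 :* m :* v :+ u :* m))
        refl m p v u ⟩
    p * (2 * m * v + u * m)         ≤⟨ ℕ.*-monoʳ-≤ p (ℕ.+-monoʳ-≤ (2 * m * v) um) ⟩
    p * (2 * m * v + (j * 2 * v + v))
      ≡⟨ solve 4 (λ m p v j →
        p :* (con 2 :* m :* v :+ (j :* con 2 :* v :+ v)) :=
        (con 2 :* (m :+ j) :+ con 1) :* p :* v) refl m p v j ⟩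
    (2 * (m + j) + 1) * p * v       ≡⟨ cong (λ a → (2 * a + 1) * p * v) m+j ⟩
    (2 * suc ℓ + 1) * p * v
      ≡⟨ solve 3 (λ ℓ p v →
        (con 2 :* (con 1 :+ ℓ) :+ con 1) :* p :* v := (con 2 :* ℓ :* p :+ con 3 :* p) :* v) refl
        ℓ p v ⟩
    (2 * ℓ * p + 3 * p) * v
      ≤⟨ ℕ.*-monoˡ-≤ v (ℕ.+-monoʳ-≤ (2 * ℓ * p) (ℕ.*-mono-≤ (ℕ.n≤1+n 3) p≤q)) ⟩
    (2 * ℓ * p + 4 * q) * v
      ≡⟨ solve 4 (λ ℓ p v q →
        (con 2 :* ℓ :* p :+ con 4 :* q) :* v := (ℓ :* p :+ con 2 :* q) :* (con 2 :* v)) refl ℓ p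
        v q ⟩
    (ℓ * p + 2 * q) * (2 * v)       ∎)
    where open ℕ.≤-Reasoning

  -- Put μ = u / v and r = p / q. From 2 j ≤ μ (m + 1) + 2 follows (2 + μ) 2 j ≤ 2 μ (m + j + 1) +
  -- 4, so 2 j ≤ r (ℓ + 2) + 2, which is at most ℓ r + 6 for r ≤ 2. For r ≥ 2 the trivial j ≤ ℓ + 1
  -- suffices.
  count-exponent : ∀ {ℓ m j u v p q} .{{_ : ℕ.NonZero v}} → m + j ≡ suc ℓ →
    j * 2 * v ≤ u * suc m + v + v → 2 * u * q ≤ p * (2 * v + u) → j * 2 * q ≤ ℓ * p + 6 * q
  count-exponent {ℓ} {m} {j} {u} {v} {p} {q} m+j jv pq with ℕ.≤-total p (2 * q)
  ... | inj₂ q≤p = begin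
    j * 2 * q
      ≤⟨ ℕ.*-monoˡ-≤ q (ℕ.*-monoˡ-≤ 2 (ℕ.≤-trans (ℕ.m≤n+m j m) (ℕ.≤-reflexive m+j))) ⟩
    suc ℓ * 2 * q
      ≡⟨ solve 2 (λ ℓ q →
        (con 1 :+ ℓ) :* con 2 :* q := ℓ :* (con 2 :* q) :+ con 2 :* q) refl ℓ q ⟩
    ℓ * (2 * q) + 2 * q ≤⟨ ℕ.+-mono-≤ (ℕ.*-monoʳ-≤ ℓ q≤p) (ℕ.*-monoˡ-≤ q (ℕ.m≤m+n 2 4)) ⟩
    ℓ * p + 6 * q       ∎
    where open ℕ.≤-Reasoning
  ... | inj₁ p≤q = ℕ.*-cancelʳ-≤ (j * 2 * q) (ℓ * p + 6 * q) (2 * v + u)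
    {{ℕ.>-nonZero (ℕ.<-≤-trans (ℕ.>-nonZero⁻¹ v)
      (ℕ.≤-trans (ℕ.m≤m+n v _) (ℕ.m≤m+n (2 * v) u)))}} (begin
    j * 2 * q * (2 * v + u)
      ≡⟨ solve 4 (λ j q v u →
        j :* con 2 :* q :* (con 2 :* v :+ u) := con 2 :* q :* (j :* con 2 :* v) :+ j :*
        (con 2 :* u :* q)) refl j q v u ⟩
    2 * q * (j * 2 * v) + j * (2 * u * q) ≤⟨ ℕ.+-monoˡ-≤ _ (ℕ.*-monoʳ-≤ (2 * q) jv) ⟩
    2 * q * (u * suc m + v + v) + j * (2 * u * q)
      ≡⟨ solve 5 (λ m j q v u →
        con 2 :* q :* (u :* (con 1 :+ m) :+ v :+ v) :+ j :* (con 2 :* u :* q) :=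
        (m :+ j :+ con 1) :* (con 2 :* u :* q) :+ con 2 :* q :* (con 2 :* v)) refl m j q v u ⟩
    (m + j + 1) * (2 * u * q) + 2 * q * (2 * v)
      ≤⟨ ℕ.+-mono-≤ (ℕ.*-monoʳ-≤ (m + j + 1) pq) (ℕ.*-monoʳ-≤ (2 * q) (ℕ.m≤m+n (2 * v) u)) ⟩
    (m + j + 1) * (p * (2 * v + u)) + 2 * q * (2 * v + u)
      ≡⟨ solve 4 (λ a p q w → a :* (p :* w) :+ con 2 :* q :* w := (a :* p :+ con 2 :* q) :* w)
        refl (m + j + 1) p q (2 * v + u) ⟩
    ((m + j + 1) * p + 2 * q) * (2 * v + u) ≤⟨ ℕ.*-monoˡ-≤ (2 * v + u) final ⟩
    (ℓ * p + 6 * q) * (2 * v + u) ∎)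
    where
    open ℕ.≤-Reasoning
    final : (m + j + 1) * p + 2 * q ≤ ℓ * p + 6 * q
    final = begin
      (m + j + 1) * p + 2 * q       ≡⟨ cong (λ a → (a + 1) * p + 2 * q) m+j ⟩
      (suc ℓ + 1) * p + 2 * q
        ≡⟨ solve 3 (λ ℓ p q →
          (con 1 :+ ℓ :+ con 1) :* p :+ con 2 :* q := ℓ :* p :+ con 2 :* p :+ con 2 :* q) refl ℓ
          p q ⟩
      ℓ * p + 2 * p + 2 * q
        ≤⟨ ℕ.+-monoˡ-≤ (2 * q) (ℕ.+-monoʳ-≤ (ℓ * p) (ℕ.*-monoʳ-≤ 2 p≤q)) ⟩
      ℓ * p + 2 * (2 * q) + 2 * q
        ≡⟨ solve 3 (λ ℓ p q →
          ℓ :* p :+ con 2 :* (con 2 :* q) :+ con 2 :* q := ℓ :* p :+ con 6 :* q) refl ℓ p q ⟩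
      ℓ * p + 6 * q                 ∎

  -- Adding M j to both sides of 2 j ≤ M (m + 1) + 2 gives (2 + M) j ≤ M ℓ + 2 M + 2, so j exceeds ℓ
  -- M / (2 + M) by at most a constant; the other ℓ + 1 accounts for the 1 in p / q = 1 + M / (2 +
  -- M).
  time-exponent : ∀ {ℓ m j M p q} → m + j ≡ suc ℓ → j * 2 ≤ M * suc m + 2 →
    p * (2 + M) ≡ (2 + 2 * M) * q → (suc ℓ + j) * q ≤ ℓ * p + 3 * q
  time-exponent {ℓ} {m} {j} {M} {p} {q} m+j jM pq =
    ℕ.*-cancelʳ-≤ ((suc ℓ + j) * q) (ℓ * p + 3 * q) (2 + M) (begin
    (suc ℓ + j) * q * (2 + M)
      ≡⟨ solve 4 (λ ℓ j q M →
        (con 1 :+ ℓ :+ j) :* q :* (con 2 :+ M) :=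
        ((con 1 :+ ℓ) :* (con 2 :+ M) :+ j :* M :+ j :* con 2) :* q) refl ℓ j q M ⟩
    (suc ℓ * (2 + M) + j * M + j * 2) * q
      ≤⟨ ℕ.*-monoˡ-≤ q (ℕ.+-monoʳ-≤ (suc ℓ * (2 + M) + j * M) jM) ⟩
    (suc ℓ * (2 + M) + j * M + (M * suc m + 2)) * q
      ≡⟨ solve 5 (λ ℓ j q M m →
        ((con 1 :+ ℓ) :* (con 2 :+ M) :+ j :* M :+ (M :* (con 1 :+ m) :+ con 2)) :* q :=
        ((con 1 :+ ℓ) :* (con 2 :+ M) :+ M :* (m :+ j) :+ M :+ con 2) :* q) refl ℓ j q M m ⟩
    (suc ℓ * (2 + M) + M * (m + j) + M + 2) * q
      ≡⟨ cong (λ a → (suc ℓ * (2 + M) + M * a + M + 2) * q) m+j ⟩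
    (suc ℓ * (2 + M) + M * suc ℓ + M + 2) * q
      ≡⟨ solve 3 (λ ℓ q M →
        ((con 1 :+ ℓ) :* (con 2 :+ M) :+ M :* (con 1 :+ ℓ) :+ M :+ con 2) :* q := ℓ :*
        ((con 2 :+ con 2 :* M) :* q) :+ (con 4 :+ con 3 :* M) :* q) refl ℓ q M ⟩
    ℓ * ((2 + 2 * M) * q) + (4 + 3 * M) * q
      ≤⟨ ℕ.+-monoʳ-≤ (ℓ * ((2 + 2 * M) * q))
        (ℕ.*-monoˡ-≤ q (ℕ.+-monoˡ-≤ (3 * M) (ℕ.m≤m+n 4 2))) ⟩
    ℓ * ((2 + 2 * M) * q) + (6 + 3 * M) * q       ≡⟨ cong (λ a → ℓ * a + (6 + 3 * M) * q) pq ⟨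
    ℓ * (p * (2 + M)) + (6 + 3 * M) * q
      ≡⟨ solve 4 (λ ℓ p q M →
        ℓ :* (p :* (con 2 :+ M)) :+ (con 6 :+ con 3 :* M) :* q := (ℓ :* p :+ con 3 :* q) :*
        (con 2 :+ M)) refl ℓ p q M ⟩
    (ℓ * p + 3 * q) * (2 + M)                     ∎)
    where open ℕ.≤-Reasoning

  log-≤ : ∀ {ℓ n} → 2 ^ ℓ ≤ n → ℓ ≤ ⌊log₂ n ⌋
  log-≤ {ℓ} {n} le = subst (_≤ ⌊log₂ n ⌋) (⌊log₂[2^n]⌋≡n ℓ) (⌊log₂⌋-mono-≤ le)

-- The decomposition

log-bracket : ∀ n → ∃[ ℓ ] 2 ^ ℓ ≤ suc n × suc n < 2 ^ suc ℓ
log-bracket zero = 0 , s≤s z≤n , s≤s (s≤s z≤n)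
log-bracket (suc n) with log-bracket n
... | ℓ , lower , upper with suc (suc n) ℕ.<? 2 ^ suc ℓ
...   | yes lt = ℓ , ℕ.≤-trans lower (ℕ.n≤1+n _) , lt
...   | no ≮   = suc ℓ , ℕ.≮⇒≥ ≮ , ℕ.≤-<-trans upper
  (ℕ.^-monoʳ-< 2 (s≤s (s≤s z≤n)) (ℕ.n<1+n (suc ℓ)))

-- Every monomial in `B`, `G` and `k` is at most `G * (G * B)`. The terms without the factor `suc ℓ`
-- have coefficients 37 + 13 + 22 + 106 + 52 = 230, and those with it have 47 + 56 = 103.
cost-bound : ∀ {ℓ k B G} → k ≤ G * B → 2 ^ suc ℓ ≡ G * B → 1 ≤ B → 1 ≤ G →
  mainCost ℓ k B G ≤ 230 * (suc (suc ℓ) * (G * (G * B)))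
cost-bound {ℓ} {k} {suc B-1} {suc G-1} k≤ N≡ _ _ = begin
  mainCost ℓ k B G
    ≡⟨ cong (λ N → 3 + (2 + ((suc ℓ * 11 + 3) + (2 + ((suc ℓ * 20 + 8) + ((k * 13 + 5) +
         ((suc ℓ * (N * 56 + 16) + 7) + enumerateCost B G))))))) N≡ ⟩
  3 + (2 + ((suc ℓ * 11 + 3) + (2 + ((suc ℓ * 20 + 8) + ((k * 13 + 5) +
    ((suc ℓ * (G * B * 56 + 16) + 7) + enumerateCost B G))))))
    ≡⟨ solve 4 (λ L k B G →
      con 3 :+ (con 2 :+ ((L :* con 11 :+ con 3) :+
      (con 2 :+ ((L :* con 20 :+ con 8) :+ ((k :* con 13 :+ con 5) :+
         ((L :* (G :* B :* con 56 :+ con 16) :+ con 7) :+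
          (con 2 :+ (G :* (con 5 :+
            ((G :+ G) :* (con 7 :+ (con 14 :+ (B :* con 26 :+ con 5 :+ con 27))) :+ con 17)) :+
            con 5))))))))
       := con 37 :+ con 13 :* k :+ con 22 :* G :+ con 106 :* (G :* G) :+ con 52 :*
         (G :* (G :* B))
          :+ L :* (con 47 :+ con 56 :* (G :* B))) refl (suc ℓ) k B G ⟩
  37 + 13 * k + 22 * G + 106 * (G * G) + 52 * P + suc ℓ * (47 + 56 * (G * B))
    ≤⟨ ℕ.+-mono-≤
         (ℕ.+-monoˡ-≤ (52 * P) (ℕ.+-mono-≤ (ℕ.+-mono-≤ (ℕ.+-mono-≤
           (ℕ.*-monoʳ-≤ 37 1≤P) (ℕ.*-monoʳ-≤ 13 (ℕ.≤-trans k≤ N≤P))) (ℕ.*-monoʳ-≤ 22 G≤P))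
             (ℕ.*-monoʳ-≤ 106 GG≤P)))
         (ℕ.*-monoʳ-≤ (suc ℓ) (ℕ.+-mono-≤ (ℕ.*-monoʳ-≤ 47 1≤P) (ℕ.*-monoʳ-≤ 56 N≤P))) ⟩
  37 * P + 13 * P + 22 * P + 106 * P + 52 * P + suc ℓ * (47 * P + 56 * P)
    ≡⟨ solve 2 (λ L P →
      con 37 :* P :+ con 13 :* P :+ con 22 :* P :+ con 106 :* P :+ con 52 :* P :+ L :*
      (con 47 :* P :+ con 56 :* P)
         := con 230 :* P :+ con 103 :* (L :* P)) refl (suc ℓ) P ⟩
  230 * P + 103 * (suc ℓ * P)
    ≤⟨ ℕ.+-monoʳ-≤ (230 * P) (ℕ.*-monoˡ-≤ (suc ℓ * P) (ℕ.m≤m+n 103 127)) ⟩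
  230 * P + 230 * (suc ℓ * P)
    ≡⟨ ℕ.*-distribˡ-+ 230 P (suc ℓ * P) ⟨
  230 * (suc (suc ℓ) * P) ∎
  where
  open ℕ.≤-Reasoning
  open +-*-Solver
  B = suc B-1
  G = suc G-1
  P = G * (G * B)
  N≤P : G * B ≤ P
  N≤P = ℕ.m≤n*m (G * B) G
  G≤P : G ≤ P
  G≤P = ℕ.m≤m*n G (G * B)
  GG≤P : G * G ≤ P
  GG≤P = ℕ.*-monoʳ-≤ G (ℕ.m≤m*n G B)
  1≤P : 1 ≤ P
  1≤P = ℕ.≤-trans (s≤s z≤n) G≤P

module Decomposition (x : Real) (0<x : 0ℚ ℚ<ℝ x) where
  open Logic x
  open Setup x using (Descent; Continue; descend; stop; next)
  open Main x

  -- Positivity of `x` gives 0 ≤ `approx x k` + 1; this is what makes `split` halt.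
  approx-low : ∀ k → ¬ approx x k ℤ.≤ -[1+ 1 ]
  approx-low k low with ℚ<ℝ-ℤ {x} 0ℚ 0<x
  ... | i , lt = contradiction
    (ℤ.≤-trans (approx-lower x 0ℤ 0 i lt k)
      (ℤ.≤-trans (ℤ.≤-reflexive (cong (ℤ._+ + 1) (ℤ.*-identityʳ (approx x k))))
      (ℤ.+-monoˡ-≤ (+ 1) low)))
    λ ()

  -- What the last successful test of `split` leaves behind, respectively the failing one. The case
  -- `m ≡ 0` is that of a loop whose first test fails.
  SizeCondition CountCondition : ℕ → ℕ → Set
  SizeCondition m j  = m ≡ 0 ⊎ approx x m ℤ.≤ + (j * 2)
  CountCondition m j = + (j * 2) ℤ.≤ approx x (suc m) ℤ.+ + 1

  Descent⇒Size : ∀ {m j m′ j′} → SizeCondition m j → Descent m j m′ j′ → SizeCondition m′ j′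
  Descent⇒Size c (stop _)   = c
  Descent⇒Size c (next p d) = Descent⇒Size (inj₂ p) d

  Descent⇒Count : ∀ {m j m′ j′} → Descent m j m′ j′ → CountCondition m′ j′
  Descent⇒Count (next _ d) = Descent⇒Count d
  Descent⇒Count {m} {j} (stop ≰) = subst₂ ℤ._≤_
    (solve 1 (λ d → con (+ 1) :+ (d :- con (+ 2)) :+ con (+ 1) := d) refl (+ (j * 2))) refl
    (ℤ.+-monoˡ-≤ (+ 1) (ℤ.i<j⇒suc[i]≤j (ℤ.≰⇒> ≰)))
    where open ℤ.+-*-Solver

  record Bounds (n t : ℕ) (ds : List ParamInstance) : Set where
    field
      {ℓ m j} : ℕ
      lower   : 2 ^ ℓ ≤ n
      m+j     : m + j ≡ suc ℓ
      sizeC   : SizeCondition m j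
      countC  : CountCondition m j
      time≤   : t ≤ 230 * (suc (suc ℓ) * (2 ^ j * (2 ^ j * 2 ^ m)))
      count≤  : length ds ≤ 2 ^ j * (2 ^ j + 2 ^ j)
      sizes   : All (λ J → proj₁ J ≡ 2 ^ m * 3) ds

  record Result (I : ParamInstance) : Set where
    field
      ds         : List ParamInstance
      t          : ℕ
      final      : State
      halts      : ⟨ main , initial 3-Sum I ⟩⇓[ t ] final
      prints     : output final ≡ serialiseAll ds
      equivalent : Yes (proj₂ I) ⇔ Any (λ J → Yes (proj₂ J)) ds
      bounds     : 1 ≤ proj₁ I → Bounds (proj₁ I) t ds

  initial-≈ : ∀ n (A : Vec ℤ n) →
    initial 3-Sum (n , A) ≈ ⟪ file n n 0 0 0 0 0 0 0 0 0 0 0 , toList A , [] ⟫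
  initial-≈ n A = mk≈ registers contents refl
    where
    zeros : ∀ y → 0ℤ ≡ nth (0ℤ ∷ 0ℤ ∷ 0ℤ ∷ 0ℤ ∷ 0ℤ ∷ 0ℤ ∷ 0ℤ ∷ 0ℤ ∷ 0ℤ ∷ 0ℤ ∷ 0ℤ ∷ []) y
    zeros 0 = refl
    zeros 1 = refl
    zeros 2 = refl
    zeros 3 = refl
    zeros 4 = refl
    zeros 5 = refl
    zeros 6 = refl
    zeros 7 = refl
    zeros 8 = refl
    zeros 9 = refl
    zeros 10 = refl
    zeros (suc (suc (suc (suc (suc (suc (suc (suc (suc (suc (suc _))))))))))) = refl
    registers : ∀ y → register (initial 3-Sum (n , A)) y ≡ nth
      (file n n 0 0 0 0 0 0 0 0 0 0 0) y
    registers 0             = refl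
    registers 1             = cong +_ (length-toList A)
    registers (suc (suc y)) = zeros y
    contents : ∀ a i → memory (initial 3-Sum (n , A)) a i ≡ arrays (toList A) a i
    contents zero    i = refl
    contents (suc a) i = refl

  result : ∀ I → Result I
  result (zero , []) = record
    { halts      = ⇓if-true refl ⇓skip
    ; ds         = []
    ; prints     = refl
    ; equivalent = mk⇔ (λ { (() , _) }) λ ()
    ; bounds     = λ ()
    }
  result (suc n , A@(a ∷ as)) with log-bracket n
  ... | ℓ , lower , upper with descend approx-low 0 (suc ℓ)
  ...   | m , j , desc with run (exec-main (sym (length-toList A)) lower upper desc)
    (initial-≈ (suc n) A)
  ...     | t , s′ , c′ , r , t≤ , s≈ , Main.mk ds out≡ len sizes equiv = record
    { halts      = r
    ; prints     = trans (_≈_.output≈ s≈) out≡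
    ; equivalent = mk⇔ (λ y → Equivalence.to equiv (Yes⇒Solvable A y))
      (λ y → Solvable⇒Yes A (Equivalence.from equiv y))
    ; bounds     = λ _ → record
      { lower  = lower
      ; m+j    = Descent-+ desc
      ; sizeC  = Descent⇒Size (inj₁ refl) desc
      ; countC = Descent⇒Count desc
      ; time≤  = ℕ.≤-trans t≤
        (cost-bound {ℓ} (ℕ.≤-trans (ℕ.m∸n≤m _ (suc n)) (ℕ.≤-reflexive N≡)) N≡ (ℕ.m^n>0 2 m)
        (ℕ.m^n>0 2 j))
      ; count≤ = len
      ; sizes  = sizes
      }
    }
    where
    N≡ : 2 ^ suc ℓ ≡ 2 ^ j * 2 ^ m
    N≡ = trans (cong (2 ^_) (sym (Descent-+ desc)))
      (trans (ℕ.^-distribˡ-+-* 2 m j) (ℕ.*-comm (2 ^ m) (2 ^ j)))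

  -- An integer upper bound for `x`: the first approximation is off by at most 1.
  approx-slope : ℕ
  approx-slope = suc ∣ approx x 1 ∣

  approx-linear : ∀ k → approx x k ℤ.≤ + (approx-slope * k + 1)
  approx-linear k = begin
    approx x k                                    ≡⟨ ℤ.*-identityʳ (approx x k) ⟨
    approx x k ℤ.* + 1                            ≤⟨ approx-≤ x k 1 ⟩
    approx x 1 ℤ.* + k ℤ.+ + (k + 1)
      ≤⟨ ℤ.+-monoˡ-≤ (+ (k + 1)) (ℤ.*-monoʳ-≤-nonNeg (+ k) (i≤∣i∣ (approx x 1))) ⟩
    + ∣ approx x 1 ∣ ℤ.* + k ℤ.+ + (k + 1)
      ≡⟨ cong (ℤ._+ + (k + 1)) (ℤ.pos-* ∣ approx x 1 ∣ k) ⟨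
    + (∣ approx x 1 ∣ * k + (k + 1))
      ≡⟨ cong +_ (solve 2 (λ a k → a :* k :+ (k :+ con 1) := (con 1 :+ a) :* k :+ con 1) refl ∣
        approx x 1 ∣ k) ⟩
    + (approx-slope * k + 1)                      ∎
    where
    open ℤ.≤-Reasoning
    open +-*-Solver

  α : ℚ
  α = + 2 ℚ./ 1

  -- 1 + M / (2 + M) for a bound M ≥ λ on the slope of the approximations.
  α′ : ℚ
  α′ = + (2 + 2 * approx-slope) ℚ./ (2 + approx-slope)

  private
    α′ᵘ : ℚᵘ
    α′ᵘ = mkℚᵘ (+ (2 + 2 * approx-slope)) (suc approx-slope)

  α′<α : α′ ℚ.< α
  α′<α = ℚ.toℚᵘ-cancel-< (ℚᵘ.<-respˡ-≃ (ℚᵘ.≃-sym (ℚ.toℚᵘ-fromℚᵘ α′ᵘ))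
    (*<* (subst₂ ℤ._<_ (sym (ℤ.*-identityʳ (+ (2 + 2 * approx-slope))))
      (ℤ.pos-* 2 (2 + approx-slope)) (+<+ lt))))
    where
    lt : 2 + 2 * approx-slope < 2 * (2 + approx-slope)
    lt = subst (2 + 2 * approx-slope <_) (sym (ℕ.*-distribˡ-+ 2 2 approx-slope))
      (ℕ.+-monoˡ-< (2 * approx-slope) (ℕ.m≤m+n 3 1))

  time-SoftO : SoftO (Result.t ∘ result) proj₁ (_≡ α′)
  -- The factor 230 is that of `cost-bound`, 2 comes from ℓ + 2 ≤ 2 (1 + log n), and 8 = 2 ^ 3 from
  -- the slack in `time-exponent`. The one logarithm is that of the sort.
  time-SoftO = 230 * 2 * 8 , 1 , λ I 1≤n r r≡ →
    bound I r (ℚᵘ.drop-*≡* (ℚᵘ.≃-trans (ℚᵘ.≃-reflexive (cong toℚᵘ r≡)) (ℚ.toℚᵘ-fromℚᵘ α′ᵘ))) 1≤n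
    where
    bound : ∀ I r → ℚᵘ.↥ toℚᵘ r ℤ.* + (2 + approx-slope) ≡ +
      (2 + 2 * approx-slope) ℤ.* ℚᵘ.↧ toℚᵘ r → 1 ≤ proj₁ I →
      Result.t (result I) ≤ 230 * 2 * 8 * suc ⌊log₂ proj₁ I ⌋ ^ 1 · proj₁ I ^ℚ r
    bound I (mkℚ (+ p) d _) pq 1≤n = ^-bound {D = 230 * (2 * log)} (suc ℓ + j) ℓ 3 p (suc d) y≤
      (ℕ.≤-reflexive (solve 1
        (λ s → con 230 :* (con 2 :* s) :* con 8 := con 230 :* con 2 :* con 8 :* (s :* con 1))
        refl log)) lower
      (time-exponent {m = m} {j} {approx-slope} {p} {suc d} m+j jM
        (ℤ.+-injective (trans (ℤ.pos-* p (2 + approx-slope))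
        (trans pq (sym (ℤ.pos-* (2 + 2 * approx-slope) (suc d)))))))
      where
      open Bounds (Result.bounds (result I) 1≤n)
      open +-*-Solver
      n = proj₁ I
      log = suc ⌊log₂ n ⌋
      y≤ : Result.t (result I) ≤ 230 * (2 * log) * 2 ^ (suc ℓ + j)
      y≤ = begin
        Result.t (result I)                                ≤⟨ time≤ ⟩
        230 * (suc (suc ℓ) * (2 ^ j * (2 ^ j * 2 ^ m)))
          ≡⟨ cong (λ a → 230 * (suc (suc ℓ) * a))
            (solve 2 (λ a b → a :* (a :* b) := b :* a :* a) refl (2 ^ j) (2 ^ m)) ⟩
        230 * (suc (suc ℓ) * (2 ^ m * 2 ^ j * 2 ^ j))
          ≡⟨ cong (λ a → 230 * (suc (suc ℓ) * (a * 2 ^ j))) (ℕ.^-distribˡ-+-* 2 m j) ⟨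
        230 * (suc (suc ℓ) * (2 ^ (m + j) * 2 ^ j))
          ≡⟨ cong (λ a → 230 * (suc (suc ℓ) * (2 ^ a * 2 ^ j))) m+j ⟩
        230 * (suc (suc ℓ) * (2 ^ suc ℓ * 2 ^ j))
          ≡⟨ cong (λ a → 230 * (suc (suc ℓ) * a)) (ℕ.^-distribˡ-+-* 2 (suc ℓ) j) ⟨
        230 * (suc (suc ℓ) * 2 ^ (suc ℓ + j))
          ≡⟨ ℕ.*-assoc 230 (suc (suc ℓ)) (2 ^ (suc ℓ + j)) ⟨
        230 * suc (suc ℓ) * 2 ^ (suc ℓ + j)
          ≤⟨ ℕ.*-monoˡ-≤ (2 ^ (suc ℓ + j)) (ℕ.*-monoʳ-≤ 230 ℓ≤) ⟩
        230 * (2 * log) * 2 ^ (suc ℓ + j)                  ∎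
        where
        open ℕ.≤-Reasoning
        ℓ≤ : suc (suc ℓ) ≤ 2 * log
        ℓ≤ = ℕ.≤-trans (s≤s (s≤s (ℕ.≤-trans (log-≤ lower) (ℕ.m≤m+n ⌊log₂ n ⌋ (⌊log₂ n ⌋ + 0)))))
          (ℕ.≤-reflexive (sym (ℕ.*-distribˡ-+ 2 1 ⌊log₂ n ⌋)))
      jM : j * 2 ≤ approx-slope * suc m + 2
      jM = ℤ.drop‿+≤+ (ℤ.≤-trans countC (ℤ.≤-trans (ℤ.+-monoˡ-≤ (+ 1) (approx-linear (suc m)))
        (ℤ.≤-reflexive (cong +_ (ℕ.+-assoc (approx-slope * suc m) 1 1)))))
    bound I (mkℚ -[1+ p ] d _) () 1≤n

  pos-2** : ∀ a b → + 2 ℤ.* + a ℤ.* + b ≡ + (2 * a * b)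
  pos-2** a b = trans (cong (ℤ._* + b) (sym (ℤ.pos-* 2 a))) (sym (ℤ.pos-* (2 * a) b))

  pos-*2*+ : ∀ p v u → + p ℤ.* (+ 2 ℤ.* + v ℤ.+ + u) ≡ + (p * (2 * v + u))
  pos-*2*+ p v u = trans (cong (λ a → + p ℤ.* (a ℤ.+ + u)) (sym (ℤ.pos-* 2 v)))
    (sym (ℤ.pos-* p (2 * v + u)))

  negative-not-above : ∀ {u d} .{c : Coprime (suc u) (suc d)} → ¬ x ℝ<ℚ mkℚ -[1+ u ] d c
  negative-not-above {u} {d} {c} x<μ with ℝ<ℚ-ℤ {x} (mkℚ -[1+ u ] d c) x<μ
  ... | k , lt = ℤ.<-irrefl refl (ℤ.≤-<-trans 0≤ (ℤ.<-≤-trans lt (≤0 k)))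
    where
    ≤0 : ∀ k → -[1+ u ] ℤ.* + k ℤ.≤ 0ℤ
    ≤0 zero    = ℤ.≤-reflexive (ℤ.*-zeroʳ -[1+ u ])
    ≤0 (suc _) = -≤+
    0≤ : 0ℤ ℤ.≤ approx x k ℤ.* + suc d ℤ.+ + suc d
    0≤ = subst (0ℤ ℤ.≤_)
      (solve 2 (λ a v → (con (+ 1) :+ a :+ con (+ 0)) :* v := a :* v :+ v) refl (approx x k)
      (+ suc d))
      (ℤ.*-monoʳ-≤-nonNeg (+ suc d)
        (subst (0ℤ ℤ.≤_) (sym (ℤ.+-identityʳ _))
        (ℤ.+-monoʳ-≤ (+ 1) (ℤ.i<j⇒suc[i]≤j (ℤ.≰⇒> (approx-low k))))))
      where open ℤ.+-*-Solver

  count-SoftO : SoftO (λ I → length (Result.ds (result I))) proj₁ (AboveCountExponent α x)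
  -- There are at most 2 g ^ 2 instances, and the slack 6 of `count-exponent` gives 2 * 2 ^ 6.
  count-SoftO = 128 , 0 , bound
    where
    bound : ∀ I → 1 ≤ proj₁ I → ∀ r → AboveCountExponent α x r →
      length (Result.ds (result I)) ≤ 128 * 1 · proj₁ I ^ℚ r
    bound I 1≤n r (mkℚ -[1+ u ] d c , x<μ , _) = contradiction x<μ negative-not-above
    bound I 1≤n r@(mkℚ -[1+ p ] e _) (μ@(mkℚ (+ u) d _) , _ , le) =
      contradiction (subst (ℤ._≤ -[1+ p ] ℤ.* (+ 2 ℤ.* + suc d ℤ.+ + u)) (pos-2** u (suc e))
        (countExponent-ℤ μ r le)) λ ()
    bound I 1≤n r@(mkℚ (+ p) e _) (μ@(mkℚ (+ u) d _) , x<μ , le) with ℝ<ℚ-ℤ {x} μ x<μ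
    ... | k , lt = ^-bound {D = 2} (j * 2) ℓ 6 p (suc e) y≤ ℕ.≤-refl lower
      (count-exponent {m = m} {j} {u} {suc d} {p} {suc e} m+j jv
        (ℤ.drop‿+≤+ (subst₂ ℤ._≤_ (pos-2** u (suc e)) (pos-*2*+ p (suc d) u)
        (countExponent-ℤ μ r le))))
      where
      open Bounds (Result.bounds (result I) 1≤n)
      y≤ : length (Result.ds (result I)) ≤ 2 * 2 ^ (j * 2)
      y≤ = ℕ.≤-trans count≤ (ℕ.≤-reflexive (trans
        (solve 1 (λ a → a :* (a :+ a) := con 2 :* (a :* (a :* con 1))) refl (2 ^ j))
          (cong (2 ℕ.*_) (ℕ.^-*-assoc 2 j 2))))
        where open +-*-Solver
      jv : j * 2 * suc d ≤ u * suc m + suc d + suc d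
      jv = ℤ.drop‿+≤+ (begin
        + (j * 2 * suc d)                                ≡⟨ ℤ.pos-* (j * 2) (suc d) ⟩
        + (j * 2) ℤ.* + suc d
          ≤⟨ ℤ.*-monoʳ-≤-nonNeg (+ suc d) countC ⟩
        (approx x (suc m) ℤ.+ + 1) ℤ.* + suc d
          ≡⟨ solve 2 (λ a v → (a :+ con (+ 1)) :* v := a :* v :+ v) refl (approx x (suc m))
            (+ suc d) ⟩
        approx x (suc m) ℤ.* + suc d ℤ.+ + suc d
          ≤⟨ ℤ.+-monoˡ-≤ (+ suc d) (approx-upper x (+ u) d k lt (suc m)) ⟩
        + u ℤ.* + suc m ℤ.+ + suc d ℤ.+ + suc d
          ≡⟨ cong (λ a → a ℤ.+ + suc d ℤ.+ + suc d) (ℤ.pos-* u (suc m)) ⟨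
        + (u * suc m + suc d + suc d)                    ∎)
        where
        open ℤ.≤-Reasoning
        open ℤ.+-*-Solver

  size-SoftO : SoftO {X = Σ ParamInstance λ I → Σ ParamInstance λ J → J ∈ Result.ds (result I)}
    (λ (_ , (m , _) , _) → m) (λ ((n , _) , _) → n) (AboveSizeExponent α x)
  -- Three blocks per instance and the slack 2 of `size-exponent` give 3 * 2 ^ 2.
  size-SoftO = 12 , 0 , bound
    where
    bound : ∀ ((I , J , _) : Σ ParamInstance λ I → Σ ParamInstance λ J →
      J ∈ Result.ds (result I)) →
      1 ≤ proj₁ I → ∀ r → AboveSizeExponent α x r → proj₁ J ≤ 12 * 1 · proj₁ I ^ℚ r
    bound _ 1≤n r (mkℚ -[1+ u ] d _ , 0<μ , _) =
      contradiction (ℚᵘ.drop-*<* (ℚ.toℚᵘ-mono-< 0<μ)) λ ()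
    bound _ 1≤n r@(mkℚ -[1+ p ] e _) (μ@(mkℚ (+ u) d _) , _ , _ , le) =
      contradiction (subst (ℤ._≤ -[1+ p ] ℤ.* (+ 2 ℤ.* + suc d ℤ.+ + u))
        (pos-2** (suc e) (suc d)) (sizeExponent-ℤ μ r le)) λ ()
    bound (I , J , J∈) 1≤n r@(mkℚ (+ p) e _)
      (μ@(mkℚ (+ u) d _) , _ , μ<x , le) with ℚ<ℝ-ℤ {x} μ μ<x
    ... | k , lt = ^-bound {D = 3} m ℓ 2 p (suc e)
      (ℕ.≤-reflexive (trans (All.lookup sizes J∈) (ℕ.*-comm (2 ^ m) 3))) ℕ.≤-refl lower
      (size-exponent {m = m} {j} {u} {suc d} {p} {suc e} m+j um
        (ℤ.drop‿+≤+ (subst₂ ℤ._≤_ (pos-2** (suc e) (suc d)) (pos-*2*+ p (suc d) u)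
        (sizeExponent-ℤ μ r le))))
      where
      open Bounds (Result.bounds (result I) 1≤n)
      um : m ≡ 0 ⊎ u * m ≤ j * 2 * suc d + suc d
      um with sizeC
      ... | inj₁ m≡0 = inj₁ m≡0
      ... | inj₂ am≤ = inj₂ (ℤ.drop‿+≤+ (begin
        + (u * m)                                ≡⟨ ℤ.pos-* u m ⟩
        + u ℤ.* + m                              ≤⟨ approx-lower x (+ u) d k lt m ⟩
        approx x m ℤ.* + suc d ℤ.+ + suc d
          ≤⟨ ℤ.+-monoˡ-≤ (+ suc d) (ℤ.*-monoʳ-≤-nonNeg (+ suc d) am≤) ⟩
        + (j * 2) ℤ.* + suc d ℤ.+ + suc d
          ≡⟨ cong (ℤ._+ + suc d) (ℤ.pos-* (j * 2) (suc d)) ⟨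
        + (j * 2 * suc d + suc d)                ∎))
        where open ℤ.≤-Reasoning

  decomposes : Decomposes α 3-Sum main x
  decomposes = record
    { decomposition = Result.ds ∘ result
    ; time          = Result.t ∘ result
    ; final         = Result.final ∘ result
    ; halts         = Result.halts ∘ result
    ; prints        = Result.prints ∘ result
    ; α′            = α′
    ; α′<α          = α′<α
    ; time-bound    = time-SoftO
    ; count-bound   = count-SoftO
    ; equivalent    = Result.equivalent ∘ result
    ; size-bound    = size-SoftO
    }

lemma3p4 : (+ 2 / 1) -OR-Decomposable 3-Sum
lemma3p4 = ℚ.*<* (+<+ (s≤s (s≤s z≤n))) , main , λ x 0<x → Decomposition.decomposes x 0<x
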